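{- Let $t\geq 2$ be an integer. Then for all sufficiently large $n$ (depending on $t$), $ex(n,H_{t,t})\leq 2^{16}\, t\, n^{\frac{4t}{2t+1}}$.
   Context: $ex(n,H)$ is the maximum number of edges in an $n$-vertex graph containing no subgraph isomorphic to $H$. For positive integers $s,t$, the graph $H_{s,t}$ is defined as follows: take an $s$-matching $x_1y_1,\dots,x_sy_s$ and a vertex-disjoint $t$-matching $x'_1y'_1,\dots,x'_ty'_t$, and add the edges $x_ix'_j$ and $y_iy'_j$ for all $i\in[s]$, $j\in[t]$. (So $H_{1,1}=C_4$ and $H_{2,2}$ is the 3-dimensional cube $Q_3$.) -}

module Defs where

open import Data.Nat using (ℕ; _<_; _<ᵇ_)
open import Data.Bool using (Bool; true; false; if_then_else_; _∧_)
open import Data.Fin using (Fin; toℕ)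
open import Data.List using (map; allFin)
open import Data.Nat.ListAction using (sum)
open import Data.Sum using (_⊎_; inj₁; inj₂)
open import Data.Product using (Σ; _×_)
open import Function.Definitions using (Injective)
open import Relation.Binary.PropositionalEquality using (_≡_)

record SimpleGraph (n : ℕ) : Set where
  field
    adj    : Fin n → Fin n → Bool
    sym    : ∀ i j → adj i j ≡ adj j i
    irrefl : ∀ i → adj i i ≡ false
open SimpleGraph public

edgeCount : ∀ {n} → SimpleGraph n → ℕ
edgeCount {n} G =
  sum (map (λ i → sum (map (λ j → if (toℕ i <ᵇ toℕ j) ∧ adj G i j then 1 else 0)
                           (allFin n)))
           (allFin n))

data HVertex (s t : ℕ) : Set where
  x  : Fin s → HVertex s t
  y  : Fin s → HVertex s t
  x' : Fin t → HVertex s t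
  y' : Fin t → HVertex s t

-- Edges of H_{s,t} (each edge listed once, in one orientation).
data HEdge (s t : ℕ) : HVertex s t → HVertex s t → Set where
  xy     : ∀ i   → HEdge s t (x i) (y i)
  x'y'   : ∀ j   → HEdge s t (x' j) (y' j)
  xx'    : ∀ i j → HEdge s t (x i) (x' j)
  yy'    : ∀ i j → HEdge s t (y i) (y' j)

ContainsH : ∀ {n} (s t : ℕ) → SimpleGraph n → Set
ContainsH {n} s t G =
  Σ (HVertex s t → Fin n) λ f →
    Injective _≡_ _≡_ f × (∀ u v → HEdge s t u v → adj G (f u) (f v) ≡ true)

{-# OPTIONS --safe #-}

-- Pass to a bipartite subgraph, seen as a 0-1 matrix M, and split its vertices so that all degrees are at most twice the
-- average; a copy of H = H_{t,t} in the split graph projects injectively, since two vertices of H in one colour class have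
-- a common neighbour.  Write 2δ for the degree bound.  Two edges v w and y x are linked if v w y x is a four-cycle, and H is
-- a K_{t,t} of links between two t-matchings, so one double counts the edges linked to all members of a t-matching.
--
-- The danger is that the edges linked to a matching mostly form a star.  To control stars, only a subfamily of the
-- four-cycles through each edge v w is used, in which every path of length two lies in at most Θ cycles.  A maximal such
-- family still contains a constant proportion of the cycles: otherwise the saturated vertices y, few in number, carry so
-- many cycles that the Kővári–Sós–Turán argument produces K_{2t,2t}, which contains H.  For a star with centre v whose
-- leaves lie in the common neighbourhood B of y_1, ..., y_t, H-freeness bounds the number of such v adjacent to t given
-- vertices, whether these are the partners x_1, ..., x_t or t vertices of B itself.  The first use bounds the number of
-- stars, the second the t-th moment of their sizes, and together they bound the total size.  Both constraints on Θ can be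
-- met as soon as the number of edges exceeds the claimed bound.

module Submission where

open import Data.Bool using (Bool; true; false; T; _∧_; _∨_; not; if_then_else_)
open import Data.Bool.Properties using (∧-conicalˡ; ∧-conicalʳ)
open import Data.Empty using (⊥; ⊥-elim)
open import Data.Fin using (Fin; zero; suc; toℕ; _↑ˡ_; _↑ʳ_; splitAt)
import Data.Fin.Properties as Fin
open import Data.List using (List; []; _∷_; _++_; map; concatMap; length; allFin; cartesianProduct)
open import Data.List.Membership.Propositional using (_∈_)
open import Data.List.Membership.Propositional.Properties using (∈-cartesianProduct⁺; ∈-allFin)
open import Data.List.Properties using (map-tabulate; length-tabulate)
open import Data.List.Relation.Unary.Any using (here; there)
open import Data.Nat
open import Data.Nat.DivMod using (_/_; _%_; m≡m%n+[m/n]*n; m%n<n; m/n*n≤m; /-monoˡ-≤; m*n/n≡m)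
open import Data.Nat.ListAction using (sum)
open import Data.Nat.Properties
open import Data.Nat.Tactic.RingSolver using (solve-∀)
open import Data.Product using (∃; _×_; _,_; proj₁; proj₂; uncurry)
open import Data.Sum using (_⊎_; inj₁; inj₂)
open import Data.Vec using (Vec; []; _∷_; lookup; zip) renaming (_++_ to _++ᵛ_)
open import Data.Vec.Properties using (lookup-zip)
open import Function using (_∘_; flip; case_of_; it)
open import Function.Definitions using (Injective)
open import Relation.Binary.PropositionalEquality hiding (J)
open import Relation.Nullary using (¬_; does; yes; no)

-- Let E be the number of edges and δ = E/n. Each edge lies in about δ³/n four-cycles, and three
-- demands fix the exponent. Pairs of an edge and a linked t-matching outside large stars number at
-- most about E^t, to be compared with E(δ³/n)^t; those inside stars number at most about E δ^(2t-2)
-- Θ; and the Kővári-Sós-Turán step needs Θ^(2t-1) of order at least δ^(2t-2). The first demand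
-- reads n^(2t-1) ≪ δ^(2t+1). Eliminating Θ from the other two yields exactly the same condition, so
-- the detour through Θ costs nothing in the exponent. All of this takes place in ℕ. Roots are
-- avoided by comparing powers, and the moment arguments share one shape: a count is lowered by
-- truncated subtraction, so that its power bounds a number of tuples without conflicts from below,
-- and `young` then splits the values at a threshold chosen to make the two halves of the bound
-- equal.

private variable
  A B : Set

-- Finite sums and 0-1 indicators

∑ : List A → (A → ℕ) → ℕ
∑ L f = sum (map f L)

⟦_⟧ : Bool → ℕ
⟦ b ⟧ = if b then 1 else 0

⟦⟧≤1 : ∀ b → ⟦ b ⟧ ≤ 1
⟦⟧≤1 true  = ≤-refl
⟦⟧≤1 false = z≤n

⟦∧⟧ : ∀ p q → ⟦ p ∧ q ⟧ ≡ ⟦ p ⟧ * ⟦ q ⟧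
⟦∧⟧ true  q = sym (+-identityʳ _)
⟦∧⟧ false q = refl

⟦⟧*-≤ : ∀ b {m n} → (b ≡ true → m ≤ n) → ⟦ b ⟧ * m ≤ n
⟦⟧*-≤ true  {m} h = subst (_≤ _) (sym (+-identityʳ m)) (h refl)
⟦⟧*-≤ false h = z≤n

⟦⟧-≤ : ∀ b {n} → (b ≡ true → 1 ≤ n) → ⟦ b ⟧ ≤ n
⟦⟧-≤ true  h = h refl
⟦⟧-≤ false h = z≤n

⟦⟧-mono : ∀ p q → (p ≡ true → q ≡ true) → ⟦ p ⟧ ≤ ⟦ q ⟧
⟦⟧-mono p q h = ⟦⟧-≤ p (λ e → ≤-reflexive (sym (cong ⟦_⟧ (h e))))

true⇒1≤ : ∀ {b} → b ≡ true → 1 ≤ ⟦ b ⟧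
true⇒1≤ refl = ≤-refl

1≤⇒true : ∀ b → 1 ≤ ⟦ b ⟧ → b ≡ true
1≤⇒true true  _ = refl
1≤⇒true false ()

∧-true : ∀ {p q} → p ≡ true → q ≡ true → p ∧ q ≡ true
∧-true refl refl = refl

∧-split : ∀ {p q} → p ∧ q ≡ true → p ≡ true × q ≡ true
∧-split {p} {q} h = ∧-conicalˡ p q h , ∧-conicalʳ p q h

not-true : ∀ {p} → not p ≡ true → p ≡ false
not-true {false} _ = refl

true≢false : ∀ {b} → b ≡ true → b ≡ false → ⊥
true≢false refl ()

≤ᵇ-true⇒≤ : ∀ m n → (m ≤ᵇ n) ≡ true → m ≤ n
≤ᵇ-true⇒≤ m n h = ≤ᵇ⇒≤ m n (subst T (sym h) _)

≤⇒≤ᵇ-true : ∀ {m n} → m ≤ n → (m ≤ᵇ n) ≡ true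
≤⇒≤ᵇ-true {m} {n} h with m ≤ᵇ n | ≤⇒≤ᵇ h
... | true | _ = refl

≤ᵇ-false⇒> : ∀ m n → (m ≤ᵇ n) ≡ false → n < m
≤ᵇ-false⇒> m n h = ≰⇒> (λ le → true≢false (≤⇒≤ᵇ-true le) h)

∑-cong : ∀ (L : List A) {f g} → (∀ a → f a ≡ g a) → ∑ L f ≡ ∑ L g
∑-cong []      h = refl
∑-cong (a ∷ L) h = cong₂ _+_ (h a) (∑-cong L h)

∑-mono : ∀ (L : List A) {f g} → (∀ a → f a ≤ g a) → ∑ L f ≤ ∑ L g
∑-mono []      h = z≤n
∑-mono (a ∷ L) h = +-mono-≤ (h a) (∑-mono L h)

∑-+ : ∀ (L : List A) f g → ∑ L (λ a → f a + g a) ≡ ∑ L f + ∑ L g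
∑-+ []      f g = refl
∑-+ (a ∷ L) f g rewrite ∑-+ L f g = lem (f a) (g a) (∑ L f) (∑ L g)
  where
  lem : ∀ p q r s → p + q + (r + s) ≡ p + r + (q + s)
  lem = solve-∀

∑-* : ∀ (L : List A) c f → ∑ L (λ a → c * f a) ≡ c * ∑ L f
∑-* []      c f = sym (*-zeroʳ c)
∑-* (a ∷ L) c f rewrite ∑-* L c f = sym (*-distribˡ-+ c (f a) (∑ L f))

∑-const : ∀ (L : List A) c → ∑ L (λ _ → c) ≡ length L * c
∑-const []      c = refl
∑-const (a ∷ L) c = cong (c +_) (∑-const L c)

∑-zero : ∀ (L : List A) {f} → (∀ a → f a ≡ 0) → ∑ L f ≡ 0
∑-zero []      h = refl
∑-zero (a ∷ L) h rewrite h a = ∑-zero L h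

∑-swap : ∀ (L : List A) (K : List B) (f : A → B → ℕ) →
         ∑ L (λ a → ∑ K (f a)) ≡ ∑ K (λ b → ∑ L (λ a → f a b))
∑-swap []      K f = sym (∑-zero K (λ _ → refl))
∑-swap (a ∷ L) K f = trans (cong (∑ K (f a) +_) (∑-swap L K f))
                           (sym (∑-+ K (f a) (λ b → ∑ L (λ a' → f a' b))))

∑-++ : ∀ (L K : List A) f → ∑ (L ++ K) f ≡ ∑ L f + ∑ K f
∑-++ []      K f = refl
∑-++ (a ∷ L) K f = trans (cong (f a +_) (∑-++ L K f)) (sym (+-assoc (f a) _ _))

∑-map : ∀ (g : A → B) (L : List A) f → ∑ (map g L) f ≡ ∑ L (f ∘ g)
∑-map g []      f = refl
∑-map g (a ∷ L) f = cong (f (g a) +_) (∑-map g L f)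

∑-concatMap : ∀ (g : A → List B) (L : List A) f →
              ∑ (concatMap g L) f ≡ ∑ L (λ a → ∑ (g a) f)
∑-concatMap g []      f = refl
∑-concatMap g (a ∷ L) f = trans (∑-++ (g a) (concatMap g L) f)
                                (cong (∑ (g a) f +_) (∑-concatMap g L f))

∑-cartesian : ∀ (L : List A) (K : List B) f →
              ∑ (cartesianProduct L K) f ≡ ∑ L (λ a → ∑ K (λ b → f (a , b)))
∑-cartesian []      K f = refl
∑-cartesian (a ∷ L) K f = trans (∑-++ (map (a ,_) K) (cartesianProduct L K) f)
                                (cong₂ _+_ (∑-map (a ,_) K f) (∑-cartesian L K f))

∑-positive : ∀ (L : List A) f → 1 ≤ ∑ L f → ∃ λ a → 1 ≤ f a
∑-positive (a ∷ L) f h with f a in eq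
... | suc _ = a , ≤-trans (s≤s z≤n) (≤-reflexive (sym eq))
... | zero  = ∑-positive L f h

∑-allFin-suc : ∀ {n} (f : Fin (suc n) → ℕ) →
               ∑ (allFin (suc n)) f ≡ f zero + ∑ (allFin n) (f ∘ suc)
∑-allFin-suc {n} f = cong (λ l → f zero + sum l)
  (trans (map-tabulate suc f) (sym (map-tabulate (λ i → i) (f ∘ suc))))

_==_ : ∀ {n} → Fin n → Fin n → Bool
i == j = does (i Fin.≟ j)

==⇒≡ : ∀ {n} (i j : Fin n) → (i == j) ≡ true → i ≡ j
==⇒≡ i j h with i Fin.≟ j
... | yes e = e

==-refl : ∀ {n} (i : Fin n) → (i == i) ≡ true
==-refl i with i Fin.≟ i
... | yes _ = refl
... | no ne = ⊥-elim (ne refl)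

==-false⇒≢ : ∀ {n} (i j : Fin n) → (i == j) ≡ false → i ≢ j
==-false⇒≢ i .i h refl = true≢false (==-refl i) h

≢⇒==-false : ∀ {n} {i j : Fin n} → i ≢ j → (i == j) ≡ false
≢⇒==-false {i = i} {j} ne with i Fin.≟ j
... | yes e = ⊥-elim (ne e)
... | no _  = refl

∑-delta : ∀ {n} (i : Fin n) (f : Fin n → ℕ) → ∑ (allFin n) (λ j → ⟦ j == i ⟧ * f j) ≡ f i
∑-delta {suc n} zero f =
  trans (∑-allFin-suc (λ j → ⟦ j == zero ⟧ * f j))
  (trans (cong₂ _+_ (+-identityʳ (f zero)) (∑-zero (allFin n) (λ _ → refl)))
         (+-identityʳ (f zero)))
∑-delta {suc n} (suc i) f =
  trans (∑-allFin-suc (λ j → ⟦ j == suc i ⟧ * f j)) (∑-delta i (f ∘ suc))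

length-allFin : ∀ n → length (allFin n) ≡ n
length-allFin n = length-tabulate {n = n} (λ i → i)

two-products : ∀ x y → 2 * (x * y) ≤ x * x + y * y
two-products x y with ≤-total x y
... | inj₁ x≤y = subst (λ z → 2 * (x * z) ≤ x * x + z * z) (m+[n∸m]≡n x≤y)
                   (subst (2 * (x * (x + k)) ≤_) (sym (expand x k)) (m≤m+n _ (k * k)))
  where
  k = y ∸ x
  expand : ∀ x k → x * x + (x + k) * (x + k) ≡ 2 * (x * (x + k)) + k * k
  expand = solve-∀
... | inj₂ y≤x = subst (λ z → 2 * (z * y) ≤ z * z + y * y) (m+[n∸m]≡n y≤x)
                   (subst (2 * ((y + k) * y) ≤_) (sym (expand y k)) (m≤m+n _ (k * k)))
  where
  k = x ∸ y
  expand : ∀ y k → (y + k) * (y + k) + y * y ≡ 2 * ((y + k) * y) + k * k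
  expand = solve-∀

cauchy-schwarz : ∀ (L : List A) f → ∑ L f * ∑ L f ≤ length L * ∑ L (λ a → f a * f a)
cauchy-schwarz []      f = z≤n
cauchy-schwarz (a ∷ L) f = begin
  (f a + S) * (f a + S)                      ≡⟨ expand (f a) S ⟩
  f a * f a + (2 * (f a * S) + S * S)        ≤⟨ +-monoʳ-≤ (f a * f a) (+-mono-≤ cross (cauchy-schwarz L f)) ⟩
  f a * f a + ((l * (f a * f a) + Q) + l * Q) ≡⟨ collect (f a * f a) Q l ⟩
  suc l * (f a * f a + Q)                    ∎
  where
  open ≤-Reasoning
  S = ∑ L f
  Q = ∑ L (λ a → f a * f a)
  l = length L
  expand : ∀ x s → (x + s) * (x + s) ≡ x * x + (2 * (x * s) + s * s)
  expand = solve-∀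
  collect : ∀ x q l → x + ((l * x + q) + l * q) ≡ suc l * (x + q)
  collect = solve-∀
  -- AM-GM on each product `f a * f b`; the `l` squares of `f a` that it costs are the ones the
  -- right-hand side has to spare.
  cross : 2 * (f a * S) ≤ l * (f a * f a) + Q
  cross = begin
    2 * (f a * S)                          ≡⟨ *-assoc 2 (f a) S ⟨
    2 * f a * S                            ≡⟨ ∑-* L (2 * f a) f ⟨
    ∑ L (λ b → 2 * f a * f b)              ≤⟨ ∑-mono L (λ b → ≤-trans (≤-reflexive (*-assoc 2 (f a) (f b))) (two-products (f a) (f b))) ⟩
    ∑ L (λ b → f a * f a + f b * f b)      ≡⟨ ∑-+ L (λ _ → f a * f a) (λ b → f b * f b) ⟩
    ∑ L (λ _ → f a * f a) + Q              ≡⟨ cong (_+ Q) (∑-const L (f a * f a)) ⟩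
    l * (f a * f a) + Q                    ∎

-- Replaces Hölder's inequality: summed over z and with a suitable m, it bounds a first moment by a (k+1)-st moment.
young : ∀ k z m → z * m ^ k ≤ m ^ suc k + z ^ suc k
young k z m with ≤-total z m
... | inj₁ z≤m = ≤-trans (*-monoˡ-≤ (m ^ k) z≤m) (m≤m+n _ _)
... | inj₂ m≤z = ≤-trans (*-monoʳ-≤ z (^-monoˡ-≤ k m≤z)) (m≤n+m _ _)

-- Tuples

every : ∀ {n} → (A → Bool) → Vec A n → Bool
every p []       = true
every p (a ∷ as) = p a ∧ every p as

every-lookup : ∀ {n} {p : A → Bool} (as : Vec A n) → every p as ≡ true → ∀ i → p (lookup as i) ≡ true
every-lookup (a ∷ as) h zero    = proj₁ (∧-split h)
every-lookup (a ∷ as) h (suc i) = every-lookup as (proj₂ (∧-split h)) i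

lookup-every : ∀ {n} {p : A → Bool} (as : Vec A n) → (∀ i → p (lookup as i) ≡ true) → every p as ≡ true
lookup-every []       h = refl
lookup-every (a ∷ as) h = ∧-true (h zero) (lookup-every as (h ∘ suc))

vecs : ∀ n → List A → List (Vec A n)
vecs zero    L = [] ∷ []
vecs (suc n) L = concatMap (λ a → map (a ∷_) (vecs n L)) L

∑-vecs-suc : ∀ n (L : List A) f →
             ∑ (vecs (suc n) L) f ≡ ∑ L (λ a → ∑ (vecs n L) (λ as → f (a ∷ as)))
∑-vecs-suc n L f = trans (∑-concatMap _ L f) (∑-cong L (λ a → ∑-map (a ∷_) (vecs n L) f))

∑-every : ∀ n (L : List A) p → ∑ (vecs n L) (λ as → ⟦ every p as ⟧) ≡ ∑ L (⟦_⟧ ∘ p) ^ n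
∑-every zero    L p = refl
∑-every (suc n) L p = begin
  ∑ (vecs (suc n) L) (λ as → ⟦ every p as ⟧)                ≡⟨ ∑-vecs-suc n L _ ⟩
  ∑ L (λ a → ∑ (vecs n L) (λ as → ⟦ p a ∧ every p as ⟧))    ≡⟨ ∑-cong L inner ⟩
  ∑ L (λ a → S ^ n * ⟦ p a ⟧)                               ≡⟨ ∑-* L (S ^ n) (⟦_⟧ ∘ p) ⟩
  S ^ n * S                                                 ≡⟨ *-comm (S ^ n) S ⟩
  S ^ suc n                                                 ∎
  where
  open ≡-Reasoning
  S = ∑ L (⟦_⟧ ∘ p)
  inner : ∀ a → ∑ (vecs n L) (λ as → ⟦ p a ∧ every p as ⟧) ≡ S ^ n * ⟦ p a ⟧
  inner a = trans (∑-cong (vecs n L) (λ as → ⟦∧⟧ (p a) (every p as)))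
            (trans (∑-* (vecs n L) ⟦ p a ⟧ _)
            (trans (cong (⟦ p a ⟧ *_) (∑-every n L p)) (*-comm ⟦ p a ⟧ (S ^ n))))

-- A tuple of cells is thereby counted through its row tuple and its column tuple, the form in which
-- matchings are handled below.
∑-vecs-zip : ∀ n (L : List A) (K : List B) (f : Vec (A × B) n → ℕ) →
             ∑ (vecs n (cartesianProduct L K)) f
             ≡ ∑ (vecs n L) (λ as → ∑ (vecs n K) (λ bs → f (zip as bs)))
∑-vecs-zip zero    L K f = sym (+-identityʳ _)
∑-vecs-zip (suc n) L K f = begin
  ∑ (vecs (suc n) (cartesianProduct L K)) f
    ≡⟨ ∑-vecs-suc n (cartesianProduct L K) f ⟩
  ∑ (cartesianProduct L K) (λ c → ∑ (vecs n (cartesianProduct L K)) (λ cs → f (c ∷ cs)))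
    ≡⟨ ∑-cartesian L K _ ⟩
  ∑ L (λ a → ∑ K (λ b → ∑ (vecs n (cartesianProduct L K)) (λ cs → f ((a , b) ∷ cs))))
    ≡⟨ ∑-cong L (λ a → ∑-cong K (λ b → ∑-vecs-zip n L K (λ cs → f ((a , b) ∷ cs)))) ⟩
  ∑ L (λ a → ∑ K (λ b → ∑ (vecs n L) (λ as → ∑ (vecs n K) (λ bs → f ((a , b) ∷ zip as bs)))))
    ≡⟨ ∑-cong L (λ a → ∑-swap K (vecs n L) _) ⟩
  ∑ L (λ a → ∑ (vecs n L) (λ as → ∑ K (λ b → ∑ (vecs n K) (λ bs → f ((a , b) ∷ zip as bs)))))
    ≡⟨ ∑-cong L (λ a → ∑-cong (vecs n L) (λ as → sym (∑-vecs-suc n K (λ bs → f (zip (a ∷ as) bs))))) ⟩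
  ∑ L (λ a → ∑ (vecs n L) (λ as → ∑ (vecs (suc n) K) (λ bs → f (zip (a ∷ as) bs))))
    ≡⟨ sym (∑-vecs-suc n L (λ as → ∑ (vecs (suc n) K) (λ bs → f (zip as bs)))) ⟩
  ∑ (vecs (suc n) L) (λ as → ∑ (vecs (suc n) K) (λ bs → f (zip as bs))) ∎
  where open ≡-Reasoning

-- The entries of `bs` are chosen independently, each in at most `d` ways once its partner in `as`
-- is fixed. With `d` a degree bound this limits the number of matchings on given rows.
∑-every-zip-≤ : ∀ {n} (as : Vec A n) (K : List B) (q : A → B → Bool) {d} →
                (∀ a → ∑ K (λ b → ⟦ q a b ⟧) ≤ d) →
                ∑ (vecs n K) (λ bs → ⟦ every (uncurry q) (zip as bs) ⟧) ≤ d ^ n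
∑-every-zip-≤ []       K q h = ≤-refl
∑-every-zip-≤ {n = suc n} (a ∷ as) K q {d} h = begin
  ∑ (vecs (suc n) K) (λ bs → ⟦ every (uncurry q) (zip (a ∷ as) bs) ⟧)
    ≡⟨ ∑-vecs-suc n K _ ⟩
  ∑ K (λ b → ∑ (vecs n K) (λ bs → ⟦ q a b ∧ every (uncurry q) (zip as bs) ⟧))
    ≡⟨ ∑-cong K (λ b → trans (∑-cong (vecs n K) (λ bs → ⟦∧⟧ (q a b) _)) (∑-* (vecs n K) ⟦ q a b ⟧ _)) ⟩
  ∑ K (λ b → ⟦ q a b ⟧ * S)  ≡⟨ ∑-cong K (λ b → *-comm ⟦ q a b ⟧ S) ⟩
  ∑ K (λ b → S * ⟦ q a b ⟧)  ≡⟨ ∑-* K S _ ⟩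
  S * ∑ K (λ b → ⟦ q a b ⟧)  ≤⟨ *-mono-≤ (∑-every-zip-≤ as K q h) (h a) ⟩
  d ^ n * d                  ≡⟨ *-comm (d ^ n) d ⟩
  d ^ suc n                  ∎
  where
  open ≤-Reasoning
  S = ∑ (vecs n K) (λ bs → ⟦ every (uncurry q) (zip as bs) ⟧)

-- Tuples without conflicts

avoids : ∀ {n} → (A → A → Bool) → A → Vec A n → Bool
avoids c a = every (λ b → not (c a b))

-- `c` is a conflict relation: equality yields tuples with distinct entries, and `touch` yields
-- matchings.
indep : ∀ {n} → (A → A → Bool) → Vec A n → Bool
indep c []       = true
indep c (a ∷ as) = avoids c a as ∧ indep c as

module _ (L : List A) (p : A → Bool) (c : A → A → Bool) (r : ℕ)
         (few : ∀ b → ∑ L (λ a → ⟦ p a ∧ c a b ⟧) ≤ r) where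

  ∑-avoids : ∀ {n} (bs : Vec A n) →
             ∑ L (⟦_⟧ ∘ p) ≤ ∑ L (λ a → ⟦ p a ∧ avoids c a bs ⟧) + n * r
  ∑-avoids [] = ≤-trans (∑-mono L (λ a → ⟦⟧-mono (p a) (p a ∧ true) (λ e → ∧-true e refl))) (m≤m+n _ _)
  ∑-avoids {suc n} (b ∷ bs) = begin
    ∑ L (⟦_⟧ ∘ p)                                       ≤⟨ ∑-avoids bs ⟩
    ∑ L (λ a → ⟦ p a ∧ avoids c a bs ⟧) + n * r         ≤⟨ +-monoˡ-≤ (n * r) (∑-mono L (λ a → lem (p a) (avoids c a bs) (c a b))) ⟩
    ∑ L (λ a → ⟦ p a ∧ avoids c a (b ∷ bs) ⟧ + ⟦ p a ∧ c a b ⟧) + n * r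
      ≡⟨ cong (_+ n * r) (∑-+ L _ _) ⟩
    X + ∑ L (λ a → ⟦ p a ∧ c a b ⟧) + n * r             ≤⟨ +-monoˡ-≤ (n * r) (+-monoʳ-≤ X (few b)) ⟩
    X + r + n * r                                       ≡⟨ +-assoc X r (n * r) ⟩
    X + suc n * r                                       ∎
    where
    open ≤-Reasoning
    X = ∑ L (λ a → ⟦ p a ∧ avoids c a (b ∷ bs) ⟧)
    lem : ∀ x y z → ⟦ x ∧ y ⟧ ≤ ⟦ x ∧ (not z ∧ y) ⟧ + ⟦ x ∧ z ⟧
    lem false y z         = z≤n
    lem true  y false     = m≤m+n _ _
    lem true  y true      = ⟦⟧≤1 y

  -- Entries are chosen one after another, each earlier entry ruling out at most `r` candidates. A
  -- separate `k` keeps the base of the power unchanged through the induction on `n`. Thanks to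
  -- truncated subtraction, no lower bound on the number of candidates has to be assumed.
  ∑-indep : ∀ n k → n ≤ k →
            (∑ L (⟦_⟧ ∘ p) ∸ k * r) ^ n ≤ ∑ (vecs n L) (λ as → ⟦ every p as ∧ indep c as ⟧)
  ∑-indep zero    k n≤k = ≤-refl
  ∑-indep (suc n) k n<k = begin
    s * s ^ n                          ≤⟨ *-monoʳ-≤ s (∑-indep n k (<⇒≤ n<k)) ⟩
    s * ∑ (vecs n L) g                 ≡⟨ ∑-* (vecs n L) s g ⟨
    ∑ (vecs n L) (λ as → s * g as)     ≤⟨ ∑-mono (vecs n L) extend ⟩
    ∑ (vecs n L) (λ as → ∑ L (λ a → ⟦ every p (a ∷ as) ∧ indep c (a ∷ as) ⟧))
                                       ≡⟨ ∑-swap (vecs n L) L _ ⟩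
    ∑ L (λ a → ∑ (vecs n L) (λ as → ⟦ every p (a ∷ as) ∧ indep c (a ∷ as) ⟧))
                                       ≡⟨ ∑-vecs-suc n L _ ⟨
    ∑ (vecs (suc n) L) (λ as → ⟦ every p as ∧ indep c as ⟧) ∎
    where
    open ≤-Reasoning
    s = ∑ L (⟦_⟧ ∘ p) ∸ k * r
    g = λ as → ⟦ every p as ∧ indep c as ⟧
    regroup : ∀ x y z w → ⟦ (x ∧ y) ∧ (z ∧ w) ⟧ ≡ ⟦ y ∧ w ⟧ * ⟦ x ∧ z ⟧
    regroup true  y     true  w = sym (*-identityʳ _)
    regroup true  true  false w = sym (*-zeroʳ ⟦ w ⟧)
    regroup true  false false w = refl
    regroup false y     z     w = sym (*-zeroʳ ⟦ y ∧ w ⟧)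
    extend : ∀ as → s * g as ≤ ∑ L (λ a → ⟦ every p (a ∷ as) ∧ indep c (a ∷ as) ⟧)
    extend as = begin
      s * g as                                                ≡⟨ *-comm s (g as) ⟩
      g as * s                                                ≤⟨ *-monoʳ-≤ (g as) bound ⟩
      g as * ∑ L (λ a → ⟦ p a ∧ avoids c a as ⟧)              ≡⟨ ∑-* L (g as) _ ⟨
      ∑ L (λ a → g as * ⟦ p a ∧ avoids c a as ⟧)              ≡⟨ ∑-cong L (λ a → regroup (p a) (every p as) (avoids c a as) (indep c as)) ⟨
      ∑ L (λ a → ⟦ every p (a ∷ as) ∧ indep c (a ∷ as) ⟧)     ∎
      where
      bound : s ≤ ∑ L (λ a → ⟦ p a ∧ avoids c a as ⟧)
      bound = ≤-trans (∸-monoʳ-≤ (∑ L (⟦_⟧ ∘ p)) (*-monoˡ-≤ r (<⇒≤ n<k)))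
                      (m≤n+o⇒m∸n≤o (∑ L (⟦_⟧ ∘ p)) (n * r)
                        (≤-trans (∑-avoids as) (≤-reflexive (+-comm _ (n * r)))))

  pick-indep : ∀ n → n * r < ∑ L (⟦_⟧ ∘ p) →
               ∃ λ (as : Vec A n) → every p as ≡ true × indep c as ≡ true
  pick-indep n h with ∑-positive (vecs n L) _ (≤-trans (m^n>0 s n) (∑-indep n n ≤-refl))
    where
    s = ∑ L (⟦_⟧ ∘ p) ∸ n * r
    instance _ = >-nonZero (m<n⇒0<n∸m h)
  ... | as , h' = as , ∧-split (1≤⇒true _ h')

  pick-avoiding : ∀ {n} (bs : Vec A n) → n * r < ∑ L (⟦_⟧ ∘ p) →
                  ∃ λ a → p a ≡ true × avoids c a bs ≡ true
  pick-avoiding {n} bs h with ∑-positive L _ (+-cancelʳ-≤ (n * r) 1 _ (≤-trans h (∑-avoids bs)))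
  ... | a , h' = a , ∧-split (1≤⇒true _ h')

distinct : ∀ {m n} → Vec (Fin m) n → Bool
distinct = indep _==_

few-equal : ∀ {m} (p : Fin m → Bool) b → ∑ (allFin m) (λ a → ⟦ p a ∧ a == b ⟧) ≤ 1
few-equal {m} p b = begin
  ∑ (allFin m) (λ a → ⟦ p a ∧ a == b ⟧)  ≤⟨ ∑-mono (allFin m) (λ a → ≤-trans
      (⟦⟧-mono (p a ∧ a == b) (a == b) (proj₂ ∘ ∧-split {p a})) (≤-reflexive (sym (*-identityʳ _)))) ⟩
  ∑ (allFin m) (λ a → ⟦ a == b ⟧ * 1)    ≡⟨ ∑-delta b (λ _ → 1) ⟩
  1                                      ∎
  where open ≤-Reasoning

avoids⇒≢ : ∀ {m n} (a : Fin m) (as : Vec (Fin m) n) → avoids _==_ a as ≡ true → ∀ i → a ≢ lookup as i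
avoids⇒≢ a as h i = ==-false⇒≢ a _ (not-true (every-lookup as h i))

≢⇒avoids : ∀ {m n} (a : Fin m) (as : Vec (Fin m) n) → (∀ i → a ≢ lookup as i) → avoids _==_ a as ≡ true
≢⇒avoids a as h = lookup-every as (λ i → cong not (≢⇒==-false (h i)))

indep⇒injective : ∀ {m n} {c : A → A → Bool} (f : A → Fin m) → (∀ a b → f a ≡ f b → c a b ≡ true) →
                  (as : Vec A n) → indep c as ≡ true → Injective _≡_ _≡_ (f ∘ lookup as)
indep⇒injective f clash (a ∷ as) h {zero}  {zero}  e = refl
indep⇒injective f clash (a ∷ as) h {zero}  {suc j} e =
  ⊥-elim (true≢false (clash _ _ e) (not-true (every-lookup as (proj₁ (∧-split h)) j)))
indep⇒injective f clash (a ∷ as) h {suc i} {zero}  e =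
  ⊥-elim (true≢false (clash _ _ (sym e)) (not-true (every-lookup as (proj₁ (∧-split h)) i)))
indep⇒injective f clash (a ∷ as) h {suc i} {suc j} e = cong suc (indep⇒injective f clash as (proj₂ (∧-split h)) e)

≡⇒== : ∀ {n} (i j : Fin n) → i ≡ j → (i == j) ≡ true
≡⇒== i .i refl = ==-refl i

distinct⇒injective : ∀ {m n} (as : Vec (Fin m) n) → distinct as ≡ true → Injective _≡_ _≡_ (lookup as)
distinct⇒injective as = indep⇒injective (λ i → i) ≡⇒== as

-- Zero-one matrices

Matrix : ℕ → ℕ → Set
Matrix a b = Fin a → Fin b → Bool

-- H_{t,t} with x = R, y = P, x' = Q, y' = S; its two colour classes {x, y'} and {y, x'} are sent to rows and columns.
record Pattern {a b} (t : ℕ) (M : Matrix a b) : Set where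
  field
    R S   : Fin t → Fin a
    P Q   : Fin t → Fin b
    R-inj : Injective _≡_ _≡_ R
    S-inj : Injective _≡_ _≡_ S
    P-inj : Injective _≡_ _≡_ P
    Q-inj : Injective _≡_ _≡_ Q
    R≢S   : ∀ i j → R i ≢ S j
    P≢Q   : ∀ i j → P i ≢ Q j
    RQ    : ∀ i j → M (R i) (Q j) ≡ true
    SP    : ∀ i j → M (S i) (P j) ≡ true
    RP    : ∀ i → M (R i) (P i) ≡ true
    SQ    : ∀ i → M (S i) (Q i) ≡ true

-- Swapping the colour classes is an automorphism of H_{t,t}; it lets each estimate proved for rows
-- be applied to columns.
transpose-pattern : ∀ {a b t} {M : Matrix a b} → Pattern t (flip M) → Pattern t M
transpose-pattern p = record
  { R = P ; S = Q ; P = R ; Q = S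
  ; R-inj = P-inj ; S-inj = Q-inj ; P-inj = R-inj ; Q-inj = S-inj
  ; R≢S = P≢Q ; P≢Q = R≢S
  ; RQ = λ i j → SP j i ; SP = λ i j → RQ j i ; RP = RP ; SQ = SQ }
  where open Pattern p

rowSum : ∀ {a b} → Matrix a b → Fin a → ℕ
rowSum {b = b} M v = ∑ (allFin b) (λ x → ⟦ M v x ⟧)

colSum : ∀ {a b} → Matrix a b → Fin b → ℕ
colSum {a} M x = ∑ (allFin a) (λ v → ⟦ M v x ⟧)

size : ∀ {a b} → Matrix a b → ℕ
size {a} M = ∑ (allFin a) (rowSum M)

size-flip : ∀ {a b} (M : Matrix a b) → size (flip M) ≡ size M
size-flip {a} {b} M = ∑-swap (allFin b) (allFin a) (λ x v → ⟦ M v x ⟧)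

-- In K_{2t,2t} any halving of the two sides will do. The size enters as an equation because it
-- arises as one vertex plus a tuple of length 2t - 1.
clique⇒pattern : ∀ {a b t n} {M : Matrix a b} → n ≡ t + t →
                 (rs : Vec (Fin a) n) → distinct rs ≡ true →
                 (cs : Vec (Fin b) n) → distinct cs ≡ true →
                 (∀ i j → M (lookup rs i) (lookup cs j) ≡ true) → Pattern t M
clique⇒pattern {t = t} refl rs rd cs cd h = record
  { R = lookup rs ∘ (_↑ˡ t) ; S = lookup rs ∘ (t ↑ʳ_)
  ; P = lookup cs ∘ (_↑ˡ t) ; Q = lookup cs ∘ (t ↑ʳ_)
  ; R-inj = Fin.↑ˡ-injective t _ _ ∘ distinct⇒injective rs rd
  ; S-inj = Fin.↑ʳ-injective t _ _ ∘ distinct⇒injective rs rd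
  ; P-inj = Fin.↑ˡ-injective t _ _ ∘ distinct⇒injective cs cd
  ; Q-inj = Fin.↑ʳ-injective t _ _ ∘ distinct⇒injective cs cd
  ; R≢S = λ i j → left≢right i j ∘ distinct⇒injective rs rd
  ; P≢Q = λ i j → left≢right i j ∘ distinct⇒injective cs cd
  ; RQ = λ i j → h _ _ ; SP = λ i j → h _ _ ; RP = λ i → h _ _ ; SQ = λ i → h _ _ }
  where
  left≢right : ∀ (i j : Fin t) → i ↑ˡ t ≢ t ↑ʳ j
  left≢right i j e with trans (sym (Fin.splitAt-↑ˡ t i t)) (trans (cong (splitAt t) e) (Fin.splitAt-↑ʳ t t j))
  ... | ()

every-++ : ∀ {A : Set} {m n} {p : A → Bool} (as : Vec A m) (bs : Vec A n) →
           every p (as ++ᵛ bs) ≡ true → every p as ≡ true × every p bs ≡ true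
every-++ []       bs h = refl , h
every-++ (a ∷ as) bs h with ∧-split h
... | h₁ , h₂ with every-++ as bs h₂
... | h₃ , h₄ = ∧-true h₁ h₃ , h₄

every-zip : ∀ {A B : Set} {n} {q : A × B → Bool} (as : Vec A n) (bs : Vec B n) →
            every q (zip as bs) ≡ true → ∀ i → q (lookup as i , lookup bs i) ≡ true
every-zip {q = q} as bs h i = trans (cong q (sym (lookup-zip i as bs))) (every-lookup (zip as bs) h i)

zip-every : ∀ {A B : Set} {n} {q : A × B → Bool} (as : Vec A n) (bs : Vec B n) →
            (∀ i → q (lookup as i , lookup bs i) ≡ true) → every q (zip as bs) ≡ true
zip-every {q = q} as bs h = lookup-every (zip as bs) (λ i → trans (cong q (lookup-zip i as bs)) (h i))

∑-guard : ∀ {A : Set} (L : List A) (q : A → Bool) g {n} → (∀ a → q a ≡ true → g ≡ true) →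
          (g ≡ true → ∑ L (⟦_⟧ ∘ q) ≤ n) → ∑ L (⟦_⟧ ∘ q) ≤ ⟦ g ⟧ * n
∑-guard L q true  h le = ≤-trans (le refl) (≤-reflexive (sym (+-identityʳ _)))
∑-guard L q false h le = ≤-reflexive (∑-zero L zeros)
  where
  zeros : ∀ a → ⟦ q a ⟧ ≡ 0
  zeros a with q a | h a
  ... | true  | h' = case h' refl of λ ()
  ... | false | _  = refl

-- Heavy rows

module _ {a b : ℕ} (t : ℕ) (M : Matrix a b) where

  common : ∀ {n} → Vec (Fin a) n → Fin b → Bool
  common ys x = every (λ y → M y x) ys

  -- The threshold 2t leaves room for choosing partners: among the common neighbours, the t entries
  -- of `ps` and fewer than t earlier choices may have to be skipped.
  heavy : ∀ {n} → Vec (Fin a) n → Fin a → Bool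
  heavy ys v = avoids _==_ v ys ∧ (t + t ≤ᵇ ∑ (allFin b) (λ x → ⟦ M v x ∧ common ys x ⟧))

  heavy⇒avoids : ∀ {n} (ys : Vec (Fin a) n) v → heavy ys v ≡ true → avoids _==_ v ys ≡ true
  heavy⇒avoids ys v h = proj₁ (∧-split h)

  heavy⇒≤ : ∀ {n} (ys : Vec (Fin a) n) v → heavy ys v ≡ true →
            t + t ≤ ∑ (allFin b) (λ x → ⟦ M v x ∧ common ys x ⟧)
  heavy⇒≤ ys v h = ≤ᵇ-true⇒≤ _ _ (proj₂ (∧-split {avoids _==_ v ys} h))

  private
    choose : (ys : Vec (Fin a) t) (ps : Vec (Fin b) t) → ∀ k → k ≤ t → (vs : Vec (Fin a) k) →
             every (heavy ys) vs ≡ true →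
             ∃ λ (qs : Vec (Fin b) k) → distinct qs ≡ true ×
               every (λ q → avoids _==_ q ps) qs ≡ true ×
               every (λ (v , q) → M v q ∧ common ys q) (zip vs qs) ≡ true
    choose ys ps zero    k≤t []       h = [] , refl , refl , refl
    choose ys ps (suc k) k<t (v ∷ vs) h
      with choose ys ps k (<⇒≤ k<t) vs (proj₂ (∧-split h))
    ... | qs , d , av , ok
      with pick-avoiding (allFin b) (λ x → M v x ∧ common ys x) _==_ 1 (few-equal _) (qs ++ᵛ ps)
             (≤-trans (s≤s (≤-reflexive (*-identityʳ (k + t))))
               (≤-trans (+-monoˡ-≤ t k<t) (heavy⇒≤ ys v (proj₁ (∧-split h)))))
    ... | q , good , fresh with every-++ qs ps fresh
    ... | fq , fp = q ∷ qs , ∧-true fq d , ∧-true fp av , ∧-true good ok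

  -- Of more than t such vertices, t distinct ones serve as `S`. Heaviness gives each its own
  -- partner in `Q`, adjacent to all of `ys` and outside `ps`, and this completes H on the matching
  -- formed by `ys` and `ps`.
  few-heavy : ¬ Pattern t M → (ys : Vec (Fin a) t) → distinct ys ≡ true →
              (ps : Vec (Fin b) t) → distinct ps ≡ true → every (uncurry M) (zip ys ps) ≡ true →
              ∑ (allFin a) (λ v → ⟦ heavy ys v ∧ every (M v) ps ⟧) ≤ t
  few-heavy free ys yd ps pd match = ≮⇒≥ (λ many → free (pattern′ many))
    where
    pattern′ : t < ∑ (allFin a) (λ v → ⟦ heavy ys v ∧ every (M v) ps ⟧) → Pattern t M
    pattern′ many
      with pick-indep (allFin a) (λ v → heavy ys v ∧ every (M v) ps) _==_ 1 (few-equal _) t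
             (≤-trans (s≤s (≤-reflexive (*-identityʳ t))) many)
    ... | vs , hv , vd
      with choose ys ps t ≤-refl vs (lookup-every vs (λ i → proj₁ (∧-split (every-lookup vs hv i))))
    ... | qs , qd , av , ok = record
      { R = lookup ys ; S = lookup vs ; P = lookup ps ; Q = lookup qs
      ; R-inj = distinct⇒injective ys yd ; S-inj = distinct⇒injective vs vd
      ; P-inj = distinct⇒injective ps pd ; Q-inj = distinct⇒injective qs qd
      ; R≢S = λ i j e → avoids⇒≢ _ ys (heavy⇒avoids ys _ (proj₁ (∧-split (every-lookup vs hv j)))) i (sym e)
      ; P≢Q = λ i j e → avoids⇒≢ _ ps (every-lookup qs av j) i (sym e)
      ; RQ = λ i j → every-lookup ys (proj₂ (∧-split {M (lookup vs j) (lookup qs j)} (every-zip vs qs ok j))) i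
      ; SP = λ i j → every-lookup ps (proj₂ (∧-split (every-lookup vs hv i))) j
      ; RP = every-zip ys ps match
      ; SQ = λ i → proj₁ (∧-split (every-zip vs qs ok i)) }

-- Degree-bounded families of four-cycles through an edge

-- `e` will be the graph of the pairs `y x` closing a four-cycle with a fixed edge `v w`. The degree
-- of `y` in `C` then counts the chosen cycles through the path `v w y`, and that of `x` those
-- through `w v x`. Maximality is claimed only for cells in `L`, to allow induction on the list.
record BoundedSubgraph {a b} (e : Matrix a b) (Θ : ℕ) (L : List (Fin a × Fin b)) : Set where
  field
    C       : Matrix a b
    C⊆e     : ∀ y x → C y x ≡ true → e y x ≡ true
    rows≤   : ∀ y → rowSum C y ≤ Θ
    cols≤   : ∀ x → colSum C x ≤ Θ
    maximal : ∀ y x → (y , x) ∈ L → e y x ≡ true →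
              C y x ≡ true ⊎ (Θ ≤ rowSum C y ⊎ Θ ≤ colSum C x)

greedy : ∀ {a b} (e : Matrix a b) Θ (L : List (Fin a × Fin b)) → BoundedSubgraph e Θ L
greedy {a} {b} e Θ [] = record
  { C = λ _ _ → false ; C⊆e = λ _ _ () ; rows≤ = λ y → none (allFin b) ; cols≤ = λ x → none (allFin a)
  ; maximal = λ _ _ () }
  where
  none : ∀ {A : Set} (L : List A) → ∑ L (λ _ → 0) ≤ Θ
  none L = ≤-trans (≤-reflexive (∑-zero L (λ _ → refl))) z≤n
greedy {a} {b} e Θ ((y₀ , x₀) ∷ L) = add
  where
  open BoundedSubgraph (greedy e Θ L)
  Result = BoundedSubgraph e Θ ((y₀ , x₀) ∷ L)
  keep : (e y₀ x₀ ≡ true → C y₀ x₀ ≡ true ⊎ (Θ ≤ rowSum C y₀ ⊎ Θ ≤ colSum C x₀)) → Result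
  keep h = record { C = C ; C⊆e = C⊆e ; rows≤ = rows≤ ; cols≤ = cols≤
                  ; maximal = λ { y x (here refl) → h ; y x (there i) → maximal y x i } }
  C′ : Matrix a b
  C′ y x = C y x ∨ ((y == y₀) ∧ (x == x₀))
  grow : ∀ y x → ⟦ C y x ⟧ ≤ ⟦ C′ y x ⟧
  grow y x with C y x
  ... | true  = ≤-refl
  ... | false = z≤n
  step : ∀ c p q → ⟦ c ∨ (p ∧ q) ⟧ ≤ ⟦ c ⟧ + ⟦ q ⟧ * ⟦ p ⟧
  step true  p     q     = s≤s z≤n
  step false true  true  = ≤-refl
  step false true  false = z≤n
  step false false q     = z≤n
  step′ : ∀ c p q → ⟦ c ∨ (p ∧ q) ⟧ ≤ ⟦ c ⟧ + ⟦ p ⟧ * ⟦ q ⟧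
  step′ true  p     q     = s≤s z≤n
  step′ false true  true  = ≤-refl
  step′ false true  false = z≤n
  step′ false false q     = z≤n
  grow-row : ∀ y → rowSum C′ y ≤ rowSum C y + ⟦ y == y₀ ⟧
  grow-row y = ≤-trans (∑-mono (allFin b) (λ x → step (C y x) (y == y₀) (x == x₀)))
    (≤-reflexive (trans (∑-+ (allFin b) _ _) (cong (rowSum C y +_) (∑-delta x₀ (λ _ → ⟦ y == y₀ ⟧)))))
  grow-col : ∀ x → colSum C′ x ≤ colSum C x + ⟦ x == x₀ ⟧
  grow-col x = ≤-trans (∑-mono (allFin a) (λ y → step′ (C y x) (y == y₀) (x == x₀)))
    (≤-reflexive (trans (∑-+ (allFin a) _ _) (cong (colSum C x +_) (∑-delta y₀ (λ _ → ⟦ x == x₀ ⟧)))))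
  bounded : ∀ {n n′} (p : Bool) → n′ ≤ n + ⟦ p ⟧ → n ≤ Θ → (p ≡ true → n < Θ) → n′ ≤ Θ
  bounded {n} true  g n≤Θ h = ≤-trans g (≤-trans (≤-reflexive (+-comm n 1)) (h refl))
  bounded {n} false g n≤Θ h = ≤-trans g (≤-trans (≤-reflexive (+-identityʳ n)) n≤Θ)
  extended : e y₀ x₀ ≡ true → rowSum C y₀ < Θ → colSum C x₀ < Θ → Result
  extended h ry cx = record
    { C = C′ ; C⊆e = sub ; maximal = max′
    ; rows≤ = λ y → bounded (y == y₀) (grow-row y) (rows≤ y) (λ q → subst (λ z → rowSum C z < Θ) (sym (==⇒≡ y y₀ q)) ry)
    ; cols≤ = λ x → bounded (x == x₀) (grow-col x) (cols≤ x) (λ q → subst (λ z → colSum C z < Θ) (sym (==⇒≡ x x₀ q)) cx) }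
    where
    sub : ∀ y x → C′ y x ≡ true → e y x ≡ true
    sub y x q with C y x in eq
    ... | true  = C⊆e y x eq
    ... | false with ∧-split q
    ... | q₁ , q₂ rewrite ==⇒≡ y y₀ q₁ | ==⇒≡ x x₀ q₂ = h
    max′ : ∀ y x → (y , x) ∈ ((y₀ , x₀) ∷ L) → e y x ≡ true →
           C′ y x ≡ true ⊎ (Θ ≤ rowSum C′ y ⊎ Θ ≤ colSum C′ x)
    max′ y x (here refl) _ = inj₁ (1≤⇒true _ (new (C y₀ x₀)))
      where
      new : ∀ c → 1 ≤ ⟦ c ∨ ((y₀ == y₀) ∧ (x₀ == x₀)) ⟧
      new true  = ≤-refl
      new false rewrite ==-refl y₀ | ==-refl x₀ = ≤-refl
    max′ y x (there i) q with maximal y x i q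
    ... | inj₁ c        = inj₁ (1≤⇒true _ (≤-trans (true⇒1≤ c) (grow y x)))
    ... | inj₂ (inj₁ s) = inj₂ (inj₁ (≤-trans s (∑-mono (allFin b) (λ x → grow y x))))
    ... | inj₂ (inj₂ s) = inj₂ (inj₂ (≤-trans s (∑-mono (allFin a) (λ y → grow y x))))
  add : Result
  add with e y₀ x₀ in eq
  ... | false = keep (λ h → ⊥-elim (true≢false h eq))
  ... | true with Θ ≤? rowSum C y₀ | Θ ≤? colSum C x₀
  ... | yes s | _     = keep (λ _ → inj₂ (inj₁ s))
  ... | no _  | yes s = keep (λ _ → inj₂ (inj₂ s))
  ... | no r  | no c  = extended eq (≰⇒> r) (≰⇒> c)

*-distrib-^ : ∀ m n k → (m * n) ^ k ≡ m ^ k * n ^ k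
*-distrib-^ m n zero    = refl
*-distrib-^ m n (suc k) rewrite *-distrib-^ m n k = regroup m n (m ^ k) (n ^ k)
  where
  regroup : ∀ m n p q → m * n * (p * q) ≡ m * p * (n * q)
  regroup = solve-∀

-- Given the edge `v w`, the cells of `walk` correspond to closed walks of length four, which is
-- what Cauchy-Schwarz bounds from below; those with y = v or x = w are degenerate and have to be
-- discarded.
walk fourCycle : ∀ {a b} → Matrix a b → Fin a → Fin b → Matrix a b
walk      M v w y x = M y w ∧ (M v x ∧ M y x)
fourCycle M v w y x = walk M v w y x ∧ (not (y == v) ∧ not (x == w))

record FourCycle {a b} (M : Matrix a b) (v : Fin a) (w : Fin b) (y : Fin a) (x : Fin b) : Set where
  field
    yw  : M y w ≡ true
    vx  : M v x ≡ true
    yx  : M y x ≡ true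
    y≢v : y ≢ v
    x≢w : x ≢ w

four-cycle : ∀ {a b} (M : Matrix a b) v w y x → fourCycle M v w y x ≡ true → FourCycle M v w y x
four-cycle M v w y x h with ∧-split {walk M v w y x} h
... | h₁ , h₂ with ∧-split {M y w} h₁ | ∧-split {not (y == v)} h₂
... | p , q | r , s = record
  { yw = p ; vx = proj₁ (∧-split q) ; yx = proj₂ (∧-split {M v x} q)
  ; y≢v = ==-false⇒≢ y v (not-true r) ; x≢w = ==-false⇒≢ x w (not-true s) }

module _ {a b t k : ℕ} {M : Matrix a b} (free : ¬ Pattern t M) (2t : suc (suc k) ≡ t + t)
         {Δ Θ : ℕ} .{{_ : NonZero Δ}} .{{_ : NonZero Θ}}
         (Θ-large : suc k * (2 * Δ) ^ suc k ≤ Δ * Θ ^ suc k)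
         (v : Fin a) (w : Fin b) (vw : M v w ≡ true) (deg : rowSum M v ≤ Δ)
         (sat : Fin a → Bool) where

  private
    j = suc k
    s = ∑ (allFin a) (⟦_⟧ ∘ sat)
    good : Fin b → Fin a → Bool
    good x y = fourCycle M v w y x ∧ sat y
    count : Fin b → ℕ
    count x = ∑ (allFin a) (λ y → ⟦ good x y ⟧)
    z : Fin b → ℕ
    z x = count x ∸ j * 1

    cycle : ∀ x y → good x y ≡ true → FourCycle M v w y x
    cycle x y h = four-cycle M v w y x (proj₁ (∧-split h))

    few-common : ∀ (ys : Vec (Fin a) j) →
                 ∑ (allFin b) (λ x → ⟦ every (good x) ys ∧ distinct ys ⟧) ≤ j
    few-common ys = ≮⇒≥ λ many →
      let xs , hx , xd = pick-indep (allFin b) (λ x → every (good x) ys ∧ distinct ys) _==_ 1 (few-equal _) j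
                           (≤-trans (s≤s (≤-reflexive (*-identityʳ j))) many)
          both = λ i → every-lookup xs hx i
          entry = λ i l → cycle (lookup xs i) (lookup ys l)
                            (every-lookup ys (proj₁ (∧-split (both i))) l)
          yd = proj₂ (∧-split {every (good (lookup xs zero)) ys} (both zero))
      in free (clique⇒pattern 2t
           (v ∷ ys) (∧-true (≢⇒avoids v ys (λ l e → FourCycle.y≢v (entry zero l) (sym e))) yd)
           (w ∷ xs) (∧-true (≢⇒avoids w xs (λ i e → FourCycle.x≢w (entry i zero) (sym e))) xd)
           λ { zero    zero    → vw
             ; zero    (suc i) → FourCycle.vx (entry i zero)
             ; (suc l) zero    → FourCycle.yw (entry zero l)
             ; (suc l) (suc i) → FourCycle.yx (entry i l) })

    -- Double counting of columns `x` together with j-tuples of distinct elements of `sat` that are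
    -- good for `x`: each tuple serves at most j columns.
    ∑z^j : ∑ (allFin b) (λ x → z x ^ j) ≤ j * s ^ j
    ∑z^j = begin
      ∑ (allFin b) (λ x → z x ^ j)
        ≤⟨ ∑-mono (allFin b) (λ x → ∑-indep (allFin a) (good x) _==_ 1 (few-equal _) j j ≤-refl) ⟩
      ∑ (allFin b) (λ x → ∑ (vecs j (allFin a)) (λ ys → ⟦ every (good x) ys ∧ distinct ys ⟧))
        ≡⟨ ∑-swap (allFin b) (vecs j (allFin a)) _ ⟩
      ∑ (vecs j (allFin a)) (λ ys → ∑ (allFin b) (λ x → ⟦ every (good x) ys ∧ distinct ys ⟧))
        ≤⟨ ∑-mono (vecs j (allFin a)) (λ ys → ∑-guard (allFin b) _ (every sat ys)
             (λ x h → lookup-every ys (λ l → proj₂ (∧-split {fourCycle M v w (lookup ys l) x}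
               (every-lookup ys (proj₁ (∧-split h)) l)))) (λ _ → few-common ys)) ⟩
      ∑ (vecs j (allFin a)) (λ ys → ⟦ every sat ys ⟧ * j)
        ≡⟨ ∑-cong (vecs j (allFin a)) (λ ys → *-comm ⟦ every sat ys ⟧ j) ⟩
      ∑ (vecs j (allFin a)) (λ ys → j * ⟦ every sat ys ⟧)
        ≡⟨ trans (∑-* (vecs j (allFin a)) j _) (cong (j *_) (∑-every j (allFin a) sat)) ⟩
      j * s ^ j ∎
      where open ≤-Reasoning

    count-guard : ∀ x → count x ≤ ⟦ M v x ⟧ * count x
    count-guard x = ∑-guard (allFin a) (good x) (M v x) (λ y h → FourCycle.vx (cycle x y h)) (λ _ → ≤-refl)

    count≤ : ∀ x → count x ≤ z x + j * ⟦ M v x ⟧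
    count≤ x = ≤-trans (count-guard x) (⟦⟧*-≤ (M v x) (λ e → subst (λ c → count x ≤ z x + j * ⟦ c ⟧) (sym e)
      (≤-trans (m≤n+m∸n (count x) (j * 1)) (≤-reflexive (+-comm (j * 1) (z x))))))

    λ′ = s * Θ

    -- The threshold is λ′/(2Δ), here cleared of denominators. As at most Δ columns are adjacent to
    -- `v`, those below it contribute at most λ′/2; those above it contribute at most λ′/2 by the
    -- j-th moment and `Θ-large`.
    pointwise : ∀ c z → z ≤ ⟦ c ⟧ * z → 2 * Δ * λ′ ^ k * z ≤ λ′ ^ j * ⟦ c ⟧ + (2 * Δ) ^ j * z ^ j
    pointwise false .0 z≤n = subst (_≤ λ′ ^ j * 0 + (2 * Δ) ^ j * 0) (sym (*-zeroʳ (2 * Δ * λ′ ^ k))) z≤n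
    pointwise true z _ = begin
      2 * Δ * λ′ ^ k * z                  ≡⟨ regroup (2 * Δ) (λ′ ^ k) z ⟩
      2 * Δ * z * λ′ ^ k                  ≤⟨ young k (2 * Δ * z) λ′ ⟩
      λ′ ^ j + (2 * Δ * z) ^ j            ≡⟨ cong₂ _+_ (sym (*-identityʳ (λ′ ^ j))) (*-distrib-^ (2 * Δ) z j) ⟩
      λ′ ^ j * 1 + (2 * Δ) ^ j * z ^ j    ∎
      where
      open ≤-Reasoning
      regroup : ∀ d l z → d * l * z ≡ d * z * l
      regroup = solve-∀

    z-guard : ∀ x → z x ≤ ⟦ M v x ⟧ * z x
    z-guard x = ≤-trans (∸-monoˡ-≤ (j * 1) (count-guard x)) (guarded (M v x) (count x))
      where
      guarded : ∀ c n → ⟦ c ⟧ * n ∸ j * 1 ≤ ⟦ c ⟧ * (n ∸ j * 1)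
      guarded true  n = ≤-reflexive (trans (cong (_∸ j * 1) (+-identityʳ n)) (sym (+-identityʳ _)))
      guarded false n = z≤n

    ∑z : .{{_ : NonZero s}} → ∑ (allFin b) z ≤ λ′
    ∑z = *-cancelˡ-≤ (2 * Δ * λ′ ^ k) {{m*n≢0 (2 * Δ) (λ′ ^ k) {{m*n≢0 2 Δ}} {{m^n≢0 λ′ k {{m*n≢0 s Θ}}}}}} (begin
      2 * Δ * λ′ ^ k * ∑ (allFin b) z           ≡⟨ ∑-* (allFin b) (2 * Δ * λ′ ^ k) z ⟨
      ∑ (allFin b) (λ x → 2 * Δ * λ′ ^ k * z x) ≤⟨ ∑-mono (allFin b) (λ x → pointwise (M v x) (z x) (z-guard x)) ⟩
      ∑ (allFin b) (λ x → λ′ ^ j * ⟦ M v x ⟧ + (2 * Δ) ^ j * z x ^ j)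
        ≡⟨ trans (∑-+ (allFin b) _ _) (cong₂ _+_ (∑-* (allFin b) (λ′ ^ j) _) (∑-* (allFin b) ((2 * Δ) ^ j) _)) ⟩
      λ′ ^ j * rowSum M v + (2 * Δ) ^ j * ∑ (allFin b) (λ x → z x ^ j)
        ≤⟨ +-mono-≤ (*-monoʳ-≤ (λ′ ^ j) deg) (*-monoʳ-≤ ((2 * Δ) ^ j) ∑z^j) ⟩
      λ′ ^ j * Δ + (2 * Δ) ^ j * (j * s ^ j)    ≡⟨ cong (λ′ ^ j * Δ +_) (regroup₁ ((2 * Δ) ^ j) j (s ^ j)) ⟩
      λ′ ^ j * Δ + j * (2 * Δ) ^ j * s ^ j      ≤⟨ +-monoʳ-≤ (λ′ ^ j * Δ) (*-monoˡ-≤ (s ^ j) Θ-large) ⟩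
      λ′ ^ j * Δ + Δ * Θ ^ j * s ^ j            ≡⟨ cong (λ′ ^ j * Δ +_) (trans (regroup₂ Δ (Θ ^ j) (s ^ j)) (cong (Δ *_) (sym (*-distrib-^ s Θ j)))) ⟩
      λ′ * λ′ ^ k * Δ + Δ * (λ′ * λ′ ^ k)       ≡⟨ regroup₃ λ′ (λ′ ^ k) Δ ⟩
      2 * Δ * λ′ ^ k * λ′                       ∎)
      where
      open ≤-Reasoning
      regroup₁ : ∀ d j s → d * (j * s) ≡ j * d * s
      regroup₁ = solve-∀
      regroup₂ : ∀ d t s → d * t * s ≡ d * (s * t)
      regroup₂ = solve-∀
      regroup₃ : ∀ l m d → l * m * d + d * (l * m) ≡ 2 * d * m * l
      regroup₃ = solve-∀

  -- A Kővári–Sós–Turán bound: 2t - 1 elements of sat with 2t - 1 common neighbours would span K_{2t,2t} with v and w.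
  saturated-cycles : ∑ (allFin b) (λ x → ∑ (allFin a) (λ y → ⟦ fourCycle M v w y x ∧ sat y ⟧))
                     ≤ ∑ (allFin a) (⟦_⟧ ∘ sat) * Θ + suc k * Δ
  -- The estimate for `∑z` cancels a power of `s * Θ`; for s = 0 there is nothing to count.
  saturated-cycles with s ≟ 0
  ... | yes s≡0 = ≤-trans (≤-reflexive (∑-zero (allFin b) (λ x → n≤0⇒n≡0 (≤-trans
          (∑-mono (allFin a) (λ y → ⟦⟧-mono (good x y) (sat y) (proj₂ ∘ ∧-split {fourCycle M v w y x})))
          (≤-reflexive s≡0))))) z≤n
  ... | no s≢0 = begin
    ∑ (allFin b) count                              ≤⟨ ∑-mono (allFin b) count≤ ⟩
    ∑ (allFin b) (λ x → z x + j * ⟦ M v x ⟧)        ≡⟨ trans (∑-+ (allFin b) z _) (cong (∑ (allFin b) z +_) (∑-* (allFin b) j _)) ⟩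
    ∑ (allFin b) z + j * rowSum M v                 ≤⟨ +-mono-≤ (∑z {{≢-nonZero s≢0}}) (*-monoʳ-≤ j deg) ⟩
    s * Θ + j * Δ                                   ∎
    where open ≤-Reasoning

markov : ∀ {A : Set} (L : List A) f Θ {n} → ∑ L f ≤ n → ∑ L (λ a → ⟦ Θ ≤ᵇ f a ⟧) * Θ ≤ n
markov L f Θ {n} h = begin
  ∑ L (λ a → ⟦ Θ ≤ᵇ f a ⟧) * Θ   ≡⟨ *-comm _ Θ ⟩
  Θ * ∑ L (λ a → ⟦ Θ ≤ᵇ f a ⟧)   ≡⟨ ∑-* L Θ _ ⟨
  ∑ L (λ a → Θ * ⟦ Θ ≤ᵇ f a ⟧)   ≤⟨ ∑-mono L (λ a → ≤-trans (≤-reflexive (*-comm Θ _)) (⟦⟧*-≤ (Θ ≤ᵇ f a) (≤ᵇ-true⇒≤ Θ (f a)))) ⟩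
  ∑ L f                          ≤⟨ h ⟩
  n                              ∎
  where open ≤-Reasoning

record CycleFamily {a b} (t Δ Θ : ℕ) (M : Matrix a b) (v : Fin a) (w : Fin b) : Set where
  field
    C       : Matrix a b
    cycle   : ∀ y x → C y x ≡ true → M v w ≡ true × FourCycle M v w y x
    rows≤   : ∀ y → rowSum C y ≤ Θ
    cols≤   : ∀ x → colSum C x ≤ Θ
    large   : ⟦ M v w ⟧ * size (walk M v w) ≤ 3 * size C + ⟦ M v w ⟧ * (2 * (t + t) * Δ)

module _ {a b t k : ℕ} {M : Matrix a b} (free : ¬ Pattern t M) (2t : suc (suc k) ≡ t + t)
         {Δ Θ : ℕ} .{{_ : NonZero Δ}} .{{_ : NonZero Θ}}
         (Θ-large : suc k * (2 * Δ) ^ suc k ≤ Δ * Θ ^ suc k)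
         (rows : ∀ v → rowSum M v ≤ Δ) (cols : ∀ w → colSum M w ≤ Δ) where

  -- The constant 3 pays for the chosen cycles and for the others, each of which meets a saturated
  -- row or a saturated column. By `markov` the saturated rows number at most `size C` over Θ, so
  -- `saturated-cycles` bounds the cycles through them by `size C` plus a multiple of Δ; columns
  -- behave alike. Degenerate walks add at most 2Δ.
  cycle-family : ∀ v w → CycleFamily t Δ Θ M v w
  cycle-family v w with M v w in vw
  ... | false = record { C = λ _ _ → false ; cycle = λ _ _ () ; large = subst (λ c → ⟦ c ⟧ * size (walk M v w) ≤ 3 * size none + ⟦ c ⟧ * (2 * (t + t) * Δ)) (sym vw) z≤n
                       ; rows≤ = λ y → ≤-trans (≤-reflexive (∑-zero (allFin b) (λ _ → refl))) z≤n
                       ; cols≤ = λ y → ≤-trans (≤-reflexive (∑-zero (allFin a) (λ _ → refl))) z≤n }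
    where
    none : Matrix a b
    none _ _ = false
  ... | true = record
    { C = C ; rows≤ = rows≤ ; cols≤ = cols≤
    ; cycle = λ y x h → vw , four-cycle M v w y x (C⊆e y x h)
    ; large = subst (λ c → ⟦ c ⟧ * size (walk M v w) ≤ 3 * size C + ⟦ c ⟧ * (2 * (t + t) * Δ)) (sym vw)
        (≤-trans (≤-reflexive (+-identityʳ _)) (≤-trans bound (+-monoʳ-≤ (3 * size C) (≤-reflexive (sym (+-identityʳ _)))))) }
    where
    open BoundedSubgraph (greedy (fourCycle M v w) Θ (cartesianProduct (allFin a) (allFin b)))
    satR : Fin a → Bool
    satR y = Θ ≤ᵇ rowSum C y
    satC : Fin b → Bool
    satC x = Θ ≤ᵇ colSum C x
    e = fourCycle M v w
    -- Cells in saturated columns are written in terms of `flip M`, so that the bound for rows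
    -- applies to them.
    covered : ∀ y x → ⟦ e y x ⟧ ≤ ⟦ C y x ⟧ + (⟦ e y x ∧ satR y ⟧ + ⟦ fourCycle (flip M) w v x y ∧ satC x ⟧)
    covered y x = ⟦⟧-≤ (e y x) λ h → case maximal y x (∈-cartesianProduct⁺ (∈-allFin y) (∈-allFin x)) h of λ
      { (inj₁ c)        → ≤-trans (true⇒1≤ c) (m≤m+n _ _)
      ; (inj₂ (inj₁ s)) → ≤-trans (true⇒1≤ (∧-true h (≤⇒≤ᵇ-true s))) (≤-trans (m≤m+n _ _) (m≤n+m _ ⟦ C y x ⟧))
      ; (inj₂ (inj₂ s)) → ≤-trans (true⇒1≤ (∧-true (flipped h) (≤⇒≤ᵇ-true s))) (≤-trans (m≤n+m _ ⟦ e y x ∧ satR y ⟧) (m≤n+m _ ⟦ C y x ⟧)) }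
      where
      flipped : e y x ≡ true → fourCycle (flip M) w v x y ≡ true
      flipped h with four-cycle M v w y x h
      ... | c rewrite FourCycle.yw c | FourCycle.vx c | FourCycle.yx c
                    | ≢⇒==-false (FourCycle.y≢v c) | ≢⇒==-false (FourCycle.x≢w c) = refl
    split : ∀ y x → ⟦ walk M v w y x ⟧ ≤ ⟦ e y x ⟧ + (⟦ y == v ⟧ * ⟦ M v x ⟧ + ⟦ x == w ⟧ * ⟦ M y w ⟧)
    split y x with M y w | M v x | M y x | y == v | x == w
    ... | false | _     | _     | _     | _     = z≤n
    ... | true  | false | _     | _     | _     = z≤n
    ... | true  | true  | false | _     | _     = z≤n
    ... | true  | true  | true  | true  | _     = s≤s z≤n
    ... | true  | true  | true  | false | true  = ≤-refl
    ... | true  | true  | true  | false | false = ≤-refl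
    ∑∑ : (Fin a → Fin b → ℕ) → ℕ
    ∑∑ f = ∑ (allFin a) (λ y → ∑ (allFin b) (f y))
    ∑∑-+ : ∀ f g → ∑∑ (λ y x → f y x + g y x) ≡ ∑∑ f + ∑∑ g
    ∑∑-+ f g = trans (∑-cong (allFin a) (λ y → ∑-+ (allFin b) (f y) (g y))) (∑-+ (allFin a) _ _)
    ∑∑-mono : ∀ {f g} → (∀ y x → f y x ≤ g y x) → ∑∑ f ≤ ∑∑ g
    ∑∑-mono h = ∑-mono (allFin a) (λ y → ∑-mono (allFin b) (h y))
    D = size C
    R = ∑∑ (λ y x → ⟦ e y x ∧ satR y ⟧)
    K = ∑∑ (λ y x → ⟦ fourCycle (flip M) w v x y ∧ satC x ⟧)
    R≤ : R ≤ D + suc k * Δ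
    R≤ = ≤-trans (≤-reflexive (∑-swap (allFin a) (allFin b) _))
        (≤-trans (saturated-cycles free 2t Θ-large v w vw (rows v) satR)
                 (+-monoˡ-≤ (suc k * Δ) (markov (allFin a) (rowSum C) Θ ≤-refl)))
    K≤ : K ≤ D + suc k * Δ
    K≤ = ≤-trans (saturated-cycles (free ∘ transpose-pattern) 2t Θ-large w v vw (cols w) satC)
                 (+-monoˡ-≤ (suc k * Δ) (markov (allFin b) (colSum C) Θ (≤-reflexive (size-flip C))))
    diagonal-row : ∑∑ (λ y x → ⟦ y == v ⟧ * ⟦ M v x ⟧) ≡ rowSum M v
    diagonal-row = trans (∑-cong (allFin a) (λ y → ∑-* (allFin b) ⟦ y == v ⟧ _)) (∑-delta v (λ _ → rowSum M v))
    diagonal-col : ∑∑ (λ y x → ⟦ x == w ⟧ * ⟦ M y w ⟧) ≡ colSum M w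
    diagonal-col = ∑-cong (allFin a) (λ y → ∑-delta w (λ _ → ⟦ M y w ⟧))
    bound : size (walk M v w) ≤ 3 * D + 2 * (t + t) * Δ
    bound = begin
      size (walk M v w)
        ≤⟨ ∑∑-mono split ⟩
      ∑∑ (λ y x → ⟦ e y x ⟧ + (⟦ y == v ⟧ * ⟦ M v x ⟧ + ⟦ x == w ⟧ * ⟦ M y w ⟧))
        ≡⟨ trans (∑∑-+ _ _) (cong (size e +_) (∑∑-+ _ _)) ⟩
      size e + (∑∑ (λ y x → ⟦ y == v ⟧ * ⟦ M v x ⟧) + ∑∑ (λ y x → ⟦ x == w ⟧ * ⟦ M y w ⟧))
        ≡⟨ cong (size e +_) (cong₂ _+_ diagonal-row diagonal-col) ⟩
      size e + (rowSum M v + colSum M w)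
        ≤⟨ +-mono-≤ (∑∑-mono covered) (+-mono-≤ (rows v) (cols w)) ⟩
      ∑∑ (λ y x → ⟦ C y x ⟧ + (⟦ e y x ∧ satR y ⟧ + ⟦ fourCycle (flip M) w v x y ∧ satC x ⟧)) + (Δ + Δ)
        ≡⟨ cong (_+ (Δ + Δ)) (trans (∑∑-+ _ _) (cong (D +_) (∑∑-+ _ _))) ⟩
      D + (R + K) + (Δ + Δ)
        ≤⟨ +-monoˡ-≤ (Δ + Δ) (+-monoʳ-≤ D (+-mono-≤ R≤ K≤)) ⟩
      D + (D + suc k * Δ + (D + suc k * Δ)) + (Δ + Δ)
        ≡⟨ regroup D k Δ ⟩
      3 * D + 2 * suc (suc k) * Δ
        ≡⟨ cong (λ n → 3 * D + 2 * n * Δ) 2t ⟩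
      3 * D + 2 * (t + t) * Δ ∎
      where
      open ≤-Reasoning
      regroup : ∀ d k x → d + (d + suc k * x + (d + suc k * x)) + (x + x) ≡ 3 * d + 2 * suc (suc k) * x
      regroup = solve-∀

-- Stars among the edges linked to a matching

record IsFamily {a b} (M : Matrix a b) (Θ : ℕ) (F : Fin a → Fin b → Matrix a b) : Set where
  field
    cycle : ∀ v w y x → F v w y x ≡ true → M v w ≡ true × FourCycle M v w y x
    rows≤ : ∀ v w y → rowSum (F v w) y ≤ Θ
    cols≤ : ∀ v w x → colSum (F v w) x ≤ Θ

flip-four-cycle : ∀ {a b} {M : Matrix a b} {v w y x} → FourCycle M v w y x → FourCycle (flip M) w v x y
flip-four-cycle c = record { yw = vx ; vx = yw ; yx = yx ; y≢v = x≢w ; x≢w = y≢v }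
  where open FourCycle c

flip-family : ∀ {a b Θ} {M : Matrix a b} {F} → IsFamily M Θ F → IsFamily (flip M) Θ (λ w v x y → F v w y x)
flip-family f = record
  { cycle = λ w v x y h → let m , c = cycle v w y x h in m , flip-four-cycle c
  ; rows≤ = λ w v x → cols≤ v w x ; cols≤ = λ w v y → rows≤ v w y }
  where open IsFamily f

module _ {a b n : ℕ} (F : Fin a → Fin b → Matrix a b) (ys : Vec (Fin a) n) (xs : Vec (Fin b) n) where

  joined : Fin a → Fin b → Bool
  joined v w = every (uncurry (F v w)) (zip ys xs)

  joined-lookup : ∀ v w → joined v w ≡ true → ∀ i → F v w (lookup ys i) (lookup xs i) ≡ true
  joined-lookup v w h = every-zip {q = uncurry (F v w)} ys xs h

  -- With t as first argument, the 2t leaves make the centre heavy for `ys` and allow t to be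
  -- subtracted from its degree at the cost of a factor two.
  star : ℕ → Fin a → Bool
  star t v = distinct ys ∧ (distinct xs ∧ (t + t ≤ᵇ rowSum joined v))

module _ {a b t′ : ℕ} {M : Matrix a b} (free : ¬ Pattern (suc t′) M)
         {Δ Θ : ℕ} .{{_ : NonZero Δ}} .{{_ : NonZero Θ}}
         {F : Fin a → Fin b → Matrix a b} (family : IsFamily M Θ F)
         (rows : ∀ v → rowSum M v ≤ Δ) where
  open IsFamily family

  private
    t = suc t′
    Ys = Vec (Fin a) t
    Xs = Vec (Fin b) t

    module Facts (ys : Ys) (xs : Xs) v w (h : joined F ys xs v w ≡ true) where
      c : ∀ i → M v w ≡ true × FourCycle M v w (lookup ys i) (lookup xs i)
      c i = cycle v w _ _ (joined-lookup F ys xs v w h i)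
      open module Cyc i = FourCycle (proj₂ (c i)) public
      edge : M v w ≡ true
      edge = proj₁ (c zero)
      is-common : common t M ys w ≡ true
      is-common = lookup-every ys yw
      matched : every (uncurry M) (zip ys xs) ≡ true
      matched = zip-every {q = uncurry M} ys xs yx
      fresh : avoids _==_ v ys ≡ true
      fresh = ≢⇒avoids v ys (λ i e → y≢v i (sym e))
      adjacent : every (M v) xs ≡ true
      adjacent = lookup-every xs vx

    module _ (ys : Ys) where
      β = ∑ (allFin b) (λ w → ⟦ common t M ys w ⟧)
      μ = Θ * β

      deg : Xs → Fin a → ℕ
      deg xs v = rowSum (joined F ys xs) v

      h : Xs → Fin a → Bool
      h xs v = star F ys xs t v

      z : Xs → Fin a → ℕ
      z xs v = deg xs v ∸ t * 1

      module Star (xs : Xs) (v : Fin a) (hv : h xs v ≡ true) where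
        yd : distinct ys ≡ true
        yd = proj₁ (∧-split hv)
        xd : distinct xs ≡ true
        xd = proj₁ (∧-split (proj₂ (∧-split {distinct ys} hv)))
        large : t + t ≤ deg xs v
        large = ≤ᵇ-true⇒≤ _ _ (proj₂ (∧-split {distinct xs} (proj₂ (∧-split {distinct ys} hv))))
        some : ∃ λ w → joined F ys xs v w ≡ true
        some with ∑-positive (allFin b) _ (≤-trans (s≤s z≤n) large)
        ... | w , p = w , 1≤⇒true _ p
        open Facts ys xs v (proj₁ some) (proj₂ some) public using (matched; adjacent)
        is-heavy : heavy t M ys v ≡ true
        is-heavy = ∧-true (Facts.fresh ys xs v _ (proj₂ some)) (≤⇒≤ᵇ-true (≤-trans large
          (∑-mono (allFin b) (λ w → ⟦⟧-mono (joined F ys xs v w) (M v w ∧ common t M ys w)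
             (λ j → ∧-true (Facts.edge ys xs v w j) (Facts.is-common ys xs v w j))))))

      -- `ys` extends to a matching in at most Δ^t ways, and `few-heavy` leaves each matching at
      -- most t centres, since a centre is adjacent to all of `xs`.
      count-stars : ∑ (vecs t (allFin b)) (λ xs → ∑ (allFin a) (λ v → ⟦ h xs v ⟧)) ≤ t * Δ ^ t
      count-stars = begin
        ∑ (vecs t (allFin b)) (λ xs → ∑ (allFin a) (λ v → ⟦ h xs v ⟧))
          ≤⟨ ∑-mono (vecs t (allFin b)) per-xs ⟩
        ∑ (vecs t (allFin b)) (λ xs → t * ⟦ every (uncurry M) (zip ys xs) ⟧)
          ≡⟨ ∑-* (vecs t (allFin b)) t _ ⟩
        t * ∑ (vecs t (allFin b)) (λ xs → ⟦ every (uncurry M) (zip ys xs) ⟧)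
          ≤⟨ *-monoʳ-≤ t (∑-every-zip-≤ ys (allFin b) M rows) ⟩
        t * Δ ^ t ∎
        where
        open ≤-Reasoning
        guard : Xs → Bool
        guard xs = distinct ys ∧ (distinct xs ∧ every (uncurry M) (zip ys xs))
        few : ∀ xs → guard xs ≡ true → ∑ (allFin a) (λ v → ⟦ h xs v ⟧) ≤ t
        few xs g = ≤-trans
          (∑-mono (allFin a) (λ v → ⟦⟧-mono (h xs v) (heavy t M ys v ∧ every (M v) xs)
            (λ e → ∧-true (Star.is-heavy xs v e) (Star.adjacent xs v e))))
          (few-heavy t M free ys (proj₁ (∧-split g)) xs
            (proj₁ (∧-split (proj₂ (∧-split {distinct ys} g))))
            (proj₂ (∧-split {distinct xs} (proj₂ (∧-split {distinct ys} g)))))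
        per-xs : ∀ xs → ∑ (allFin a) (λ v → ⟦ h xs v ⟧) ≤ t * ⟦ every (uncurry M) (zip ys xs) ⟧
        per-xs xs = ≤-trans
          (∑-guard (allFin a) (h xs) (guard xs)
            (λ v e → ∧-true (Star.yd xs v e) (∧-true (Star.xd xs v e) (Star.matched xs v e))) (few xs))
          (≤-trans (*-monoˡ-≤ t (⟦⟧-mono (guard xs) (every (uncurry M) (zip ys xs))
            (λ g → proj₂ (∧-split {distinct xs} (proj₂ (∧-split {distinct ys} g)))))) (≤-reflexive (*-comm _ t)))

      -- Stars are counted with t distinct marked leaves `ws`. The leaves are common neighbours of
      -- `ys`, so `ys` and `ws` form a matching to which `few-heavy` applies: at most t centres for
      -- each `ws`. Given the centre and one leaf, the cap Θ leaves at most Θ^t choices of `xs`.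
      moment : ∑ (vecs t (allFin b)) (λ xs → ∑ (allFin a) (λ v → ⟦ h xs v ⟧ * z xs v ^ t)) ≤ t * μ ^ t
      moment = begin
        ∑ (vecs t (allFin b)) (λ xs → ∑ (allFin a) (λ v → ⟦ h xs v ⟧ * z xs v ^ t))
          ≤⟨ ∑-mono (vecs t (allFin b)) (λ xs → ∑-mono (allFin a) (pointwise xs)) ⟩
        ∑ (vecs t (allFin b)) (λ xs → ∑ (allFin a) (λ v → ∑ (vecs t (allFin b)) (λ ws →
            ⟦ G ws v ⟧ * ⟦ first xs v ws ⟧)))
          ≡⟨ trans (∑-cong (vecs t (allFin b)) (λ xs → ∑-swap (allFin a) (vecs t (allFin b)) _))
                   (∑-swap (vecs t (allFin b)) (vecs t (allFin b)) _) ⟩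
        ∑ (vecs t (allFin b)) (λ ws → ∑ (vecs t (allFin b)) (λ xs → ∑ (allFin a) (λ v →
            ⟦ G ws v ⟧ * ⟦ first xs v ws ⟧)))
          ≤⟨ ∑-mono (vecs t (allFin b)) per-ws ⟩
        ∑ (vecs t (allFin b)) (λ ws → t * Θ ^ t * ⟦ every (common t M ys) ws ⟧)
          ≡⟨ trans (∑-* (vecs t (allFin b)) (t * Θ ^ t) _)
                   (cong (t * Θ ^ t *_) (∑-every t (allFin b) (common t M ys))) ⟩
        t * Θ ^ t * β ^ t
          ≡⟨ trans (*-assoc t (Θ ^ t) (β ^ t)) (cong (t *_) (sym (*-distrib-^ Θ β t))) ⟩
        t * μ ^ t ∎
        where
        open ≤-Reasoning
        -- One leaf is enough to restrict `xs`, hence only the first is recorded.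
        first : Xs → Fin a → Xs → Bool
        first xs v ws = joined F ys xs v (lookup ws zero)
        base : Xs → Bool
        base ws = distinct ys ∧ (distinct ws ∧ every (common t M ys) ws)
        G : Xs → Fin a → Bool
        G ws v = base ws ∧ (heavy t M ys v ∧ every (M v) ws)
        implies : ∀ xs v ws → h xs v ≡ true → every (joined F ys xs v) ws ∧ distinct ws ≡ true →
                  G ws v ∧ first xs v ws ≡ true
        implies xs v ws hv e = ∧-true
            (∧-true (∧-true (Star.yd xs v hv) (∧-true (proj₂ (∧-split {every (joined F ys xs v) ws} e))
                      (lookup-every ws (λ i → Facts.is-common ys xs v _ (every-lookup ws all i)))))
                    (∧-true (Star.is-heavy xs v hv)
                      (lookup-every ws (λ i → Facts.edge ys xs v _ (every-lookup ws all i)))))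
            (every-lookup ws all zero)
          where all = proj₁ (∧-split {every (joined F ys xs v) ws} e)
        pointwise : ∀ xs v → ⟦ h xs v ⟧ * z xs v ^ t ≤
                    ∑ (vecs t (allFin b)) (λ ws → ⟦ G ws v ⟧ * ⟦ first xs v ws ⟧)
        pointwise xs v = ⟦⟧*-≤ (h xs v) λ hv → ≤-trans
          (∑-indep (allFin b) (joined F ys xs v) _==_ 1 (few-equal _) t t ≤-refl)
          (∑-mono (vecs t (allFin b)) (λ ws → ≤-trans
            (⟦⟧-mono (every (joined F ys xs v) ws ∧ distinct ws) (G ws v ∧ first xs v ws) (implies xs v ws hv))
            (≤-reflexive (⟦∧⟧ (G ws v) (first xs v ws)))))
        few : ∀ ws → base ws ≡ true → ∑ (allFin a) (λ v → ⟦ G ws v ⟧) ≤ t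
        few ws g = ≤-trans
          (∑-mono (allFin a) (λ v → ⟦⟧-mono (G ws v) (heavy t M ys v ∧ every (M v) ws) (λ e → proj₂ (∧-split {base ws} e))))
          (few-heavy t M free ys (proj₁ (∧-split g)) ws (proj₁ (∧-split (proj₂ (∧-split {distinct ys} g))))
            (zip-every {q = uncurry M} ys ws (λ i → every-lookup ys (every-lookup ws
              (proj₂ (∧-split {distinct ws} (proj₂ (∧-split {distinct ys} g)))) i) i)))
        ∑G : ∀ ws → ∑ (allFin a) (λ v → ⟦ G ws v ⟧) ≤ ⟦ every (common t M ys) ws ⟧ * t
        ∑G ws = ≤-trans (∑-guard (allFin a) (G ws) (base ws) (λ v e → proj₁ (∧-split e)) (few ws))
          (*-monoˡ-≤ t (⟦⟧-mono (base ws) (every (common t M ys) ws)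
            (λ g → proj₂ (∧-split {distinct ws} (proj₂ (∧-split {distinct ys} g))))))
        per-ws : ∀ ws → ∑ (vecs t (allFin b)) (λ xs → ∑ (allFin a) (λ v → ⟦ G ws v ⟧ * ⟦ first xs v ws ⟧))
                 ≤ t * Θ ^ t * ⟦ every (common t M ys) ws ⟧
        per-ws ws = begin
          ∑ (vecs t (allFin b)) (λ xs → ∑ (allFin a) (λ v → ⟦ G ws v ⟧ * ⟦ first xs v ws ⟧))
            ≡⟨ ∑-swap (vecs t (allFin b)) (allFin a) _ ⟩
          ∑ (allFin a) (λ v → ∑ (vecs t (allFin b)) (λ xs → ⟦ G ws v ⟧ * ⟦ first xs v ws ⟧))
            ≡⟨ ∑-cong (allFin a) (λ v → ∑-* (vecs t (allFin b)) ⟦ G ws v ⟧ _) ⟩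
          ∑ (allFin a) (λ v → ⟦ G ws v ⟧ * ∑ (vecs t (allFin b)) (λ xs → ⟦ first xs v ws ⟧))
            ≤⟨ ∑-mono (allFin a) (λ v → *-monoʳ-≤ ⟦ G ws v ⟧
                 (∑-every-zip-≤ ys (allFin b) (F v (lookup ws zero)) (rows≤ v (lookup ws zero)))) ⟩
          ∑ (allFin a) (λ v → ⟦ G ws v ⟧ * Θ ^ t)
            ≡⟨ trans (∑-cong (allFin a) (λ v → *-comm ⟦ G ws v ⟧ (Θ ^ t))) (∑-* (allFin a) (Θ ^ t) _) ⟩
          Θ ^ t * ∑ (allFin a) (λ v → ⟦ G ws v ⟧)
            ≤⟨ *-monoʳ-≤ (Θ ^ t) (∑G ws) ⟩
          Θ ^ t * (⟦ every (common t M ys) ws ⟧ * t)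
            ≡⟨ regroup (Θ ^ t) ⟦ every (common t M ys) ws ⟧ t ⟩
          t * Θ ^ t * ⟦ every (common t M ys) ws ⟧ ∎
          where
          regroup : ∀ p c n → p * (c * n) ≡ n * p * c
          regroup = solve-∀

      weight : ℕ
      weight = ∑ (vecs t (allFin b)) (λ xs → ∑ (allFin a) (λ v → ⟦ h xs v ⟧ * deg xs v))

      deg≤β : ∀ xs v → deg xs v ≤ β
      deg≤β xs v = ∑-mono (allFin b) (λ w → ⟦⟧-mono (joined F ys xs v w) (common t M ys w) (Facts.is-common ys xs v w))

      halve : ∀ n → t + t ≤ n → n ≤ 2 * (n ∸ t * 1)
      halve n le rewrite *-identityʳ t = begin
        n                       ≡⟨ m∸n+n≡m (≤-trans (m≤m+n t t) le) ⟨
        n ∸ t + t               ≤⟨ +-monoʳ-≤ (n ∸ t) (m+n≤o⇒m≤o∸n t le) ⟩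
        n ∸ t + (n ∸ t)         ≡⟨ cong (n ∸ t +_) (sym (+-identityʳ (n ∸ t))) ⟩
        2 * (n ∸ t)             ∎
        where open ≤-Reasoning

      -- Star sizes are compared with μ/Δ. Below this value `count-stars` gives t Δ^t times μ/Δ;
      -- above it `moment` gives t μ^t times (Δ/μ)^(t-1); both equal t Δ^(t-1) μ. A further factor
      -- two comes from `halve`.
      weight≤ : weight ≤ 4 * t * Δ ^ t′ * μ
      weight≤ with β ≟ 0
      ... | yes β≡0 = ≤-trans (≤-reflexive (∑-zero (vecs t (allFin b)) (λ xs → ∑-zero (allFin a) (λ v →
              trans (cong (⟦ h xs v ⟧ *_) (n≤0⇒n≡0 (≤-trans (deg≤β xs v) (≤-reflexive β≡0)))) (*-zeroʳ ⟦ h xs v ⟧))))) z≤n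
      ... | no β≢0 = *-cancelˡ-≤ (Δ * μ ^ t′)
          {{m*n≢0 Δ (μ ^ t′) {{it}} {{m^n≢0 μ t′ {{m*n≢0 Θ β {{it}} {{≢-nonZero β≢0}}}}}}}} (begin
        Δ * μ ^ t′ * weight
          ≡⟨ ∑∑-* (Δ * μ ^ t′) _ ⟨
        ∑ (vecs t (allFin b)) (λ xs → ∑ (allFin a) (λ v → Δ * μ ^ t′ * (⟦ h xs v ⟧ * deg xs v)))
          ≤⟨ ∑-mono (vecs t (allFin b)) (λ xs → ∑-mono (allFin a) (pointwise xs)) ⟩
        ∑ (vecs t (allFin b)) (λ xs → ∑ (allFin a) (λ v → 2 * (μ ^ t * ⟦ h xs v ⟧ + Δ ^ t * (⟦ h xs v ⟧ * z xs v ^ t))))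
          ≡⟨ trans (∑∑-* 2 _) (cong (2 *_) (trans (∑∑-+ _ _) (cong₂ _+_ (∑∑-* (μ ^ t) _) (∑∑-* (Δ ^ t) _)))) ⟩
        2 * (μ ^ t * ∑ (vecs t (allFin b)) (λ xs → ∑ (allFin a) (λ v → ⟦ h xs v ⟧))
             + Δ ^ t * ∑ (vecs t (allFin b)) (λ xs → ∑ (allFin a) (λ v → ⟦ h xs v ⟧ * z xs v ^ t)))
          ≤⟨ *-monoʳ-≤ 2 (+-mono-≤ (*-monoʳ-≤ (μ ^ t) count-stars) (*-monoʳ-≤ (Δ ^ t) moment)) ⟩
        2 * (μ * μ ^ t′ * (t * (Δ * Δ ^ t′)) + Δ * Δ ^ t′ * (t * (μ * μ ^ t′)))
          ≡⟨ regroup μ (μ ^ t′) t Δ (Δ ^ t′) ⟩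
        Δ * μ ^ t′ * (4 * t * Δ ^ t′ * μ) ∎)
        where
        open ≤-Reasoning
        ∑∑-* : ∀ c (f : Xs → Fin a → ℕ) → ∑ (vecs t (allFin b)) (λ xs → ∑ (allFin a) (λ v → c * f xs v))
               ≡ c * ∑ (vecs t (allFin b)) (λ xs → ∑ (allFin a) (f xs))
        ∑∑-* c f = trans (∑-cong (vecs t (allFin b)) (λ xs → ∑-* (allFin a) c (f xs))) (∑-* (vecs t (allFin b)) c _)
        ∑∑-+ : ∀ (f g : Xs → Fin a → ℕ) → ∑ (vecs t (allFin b)) (λ xs → ∑ (allFin a) (λ v → f xs v + g xs v))
               ≡ ∑ (vecs t (allFin b)) (λ xs → ∑ (allFin a) (f xs)) + ∑ (vecs t (allFin b)) (λ xs → ∑ (allFin a) (g xs))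
        ∑∑-+ f g = trans (∑-cong (vecs t (allFin b)) (λ xs → ∑-+ (allFin a) (f xs) (g xs))) (∑-+ (vecs t (allFin b)) _ _)
        regroup : ∀ m p n d q → 2 * (m * p * (n * (d * q)) + d * q * (n * (m * p))) ≡ d * p * (4 * n * q * m)
        regroup = solve-∀
        core : ∀ n s → n ≤ 2 * s → Δ * μ ^ t′ * n ≤ 2 * (μ ^ t + Δ ^ t * s ^ t)
        core n s le = begin
          Δ * μ ^ t′ * n                 ≤⟨ *-monoʳ-≤ (Δ * μ ^ t′) le ⟩
          Δ * μ ^ t′ * (2 * s)           ≡⟨ regroup′ Δ (μ ^ t′) s ⟩
          2 * (Δ * s * μ ^ t′)           ≤⟨ *-monoʳ-≤ 2 (young t′ (Δ * s) μ) ⟩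
          2 * (μ ^ t + (Δ * s) ^ t)      ≡⟨ cong (λ e → 2 * (μ ^ t + e)) (*-distrib-^ Δ s t) ⟩
          2 * (μ ^ t + Δ ^ t * s ^ t)    ∎
          where
          regroup′ : ∀ d p s → d * p * (2 * s) ≡ 2 * (d * s * p)
          regroup′ = solve-∀
        scale : ∀ c {n s} → (c ≡ true → n ≤ 2 * s) →
                Δ * μ ^ t′ * (⟦ c ⟧ * n) ≤ 2 * (μ ^ t * ⟦ c ⟧ + Δ ^ t * (⟦ c ⟧ * s ^ t))
        scale true {n} {s} le = ≤-trans (≤-reflexive (cong (Δ * μ ^ t′ *_) (+-identityʳ n))) (≤-trans (core n s (le refl))
          (≤-reflexive (cong₂ (λ p q → 2 * (p + Δ ^ t * q)) (sym (*-identityʳ (μ ^ t))) (sym (+-identityʳ (s ^ t))))))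
        scale false le = ≤-trans (≤-reflexive (*-zeroʳ (Δ * μ ^ t′))) z≤n
        pointwise : ∀ xs v → Δ * μ ^ t′ * (⟦ h xs v ⟧ * deg xs v)
                    ≤ 2 * (μ ^ t * ⟦ h xs v ⟧ + Δ ^ t * (⟦ h xs v ⟧ * z xs v ^ t))
        pointwise xs v = scale (h xs v) {deg xs v} {z xs v} (λ e → halve (deg xs v) (Star.large xs v e))

  -- Summed over `ys`, the number `β` of common neighbours counts a column together with t of its
  -- neighbours, repetitions allowed, hence is at most `size M * Δ ^ t′`.
  total-stars : (∀ w → colSum M w ≤ Δ) →
                ∑ (vecs t (allFin a)) (λ ys → ∑ (vecs t (allFin b)) (λ xs → ∑ (allFin a) (λ v →
                  ⟦ star F ys xs t v ⟧ * rowSum (joined F ys xs) v)))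
                ≤ 4 * t * Δ ^ t′ * Θ * (size M * Δ ^ t′)
  total-stars cols = begin
    ∑ (vecs t (allFin a)) weight
      ≤⟨ ∑-mono (vecs t (allFin a)) (λ ys → ≤-trans (weight≤ ys) (≤-reflexive (sym (*-assoc (4 * t * Δ ^ t′) Θ (β ys))))) ⟩
    ∑ (vecs t (allFin a)) (λ ys → 4 * t * Δ ^ t′ * Θ * β ys)
      ≡⟨ ∑-* (vecs t (allFin a)) (4 * t * Δ ^ t′ * Θ) β ⟩
    4 * t * Δ ^ t′ * Θ * ∑ (vecs t (allFin a)) β
      ≡⟨ cong (4 * t * Δ ^ t′ * Θ *_) (trans (∑-swap (vecs t (allFin a)) (allFin b) _)
           (∑-cong (allFin b) (λ w → ∑-every t (allFin a) (λ y → M y w)))) ⟩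
    4 * t * Δ ^ t′ * Θ * ∑ (allFin b) (λ w → colSum M w ^ t)
      ≤⟨ *-monoʳ-≤ (4 * t * Δ ^ t′ * Θ) (∑-mono (allFin b) (λ w → ≤-trans
           (*-monoʳ-≤ (colSum M w) (^-monoˡ-≤ t′ (cols w))) (≤-reflexive (*-comm (colSum M w) (Δ ^ t′))))) ⟩
    4 * t * Δ ^ t′ * Θ * ∑ (allFin b) (λ w → Δ ^ t′ * colSum M w)
      ≡⟨ cong (4 * t * Δ ^ t′ * Θ *_) (trans (∑-* (allFin b) (Δ ^ t′) (colSum M))
           (trans (cong (Δ ^ t′ *_) (size-flip M)) (*-comm (Δ ^ t′) (size M)))) ⟩
    4 * t * Δ ^ t′ * Θ * (size M * Δ ^ t′) ∎
    where open ≤-Reasoning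

-- Matchings, and the double count of linked pairs

joined-flip : ∀ {a b n} (F : Fin a → Fin b → Matrix a b) (ys : Vec (Fin a) n) (xs : Vec (Fin b) n) v w →
              joined (λ w v x y → F v w y x) xs ys w v ≡ joined F ys xs v w
joined-flip F []       []       v w = refl
joined-flip F (y ∷ ys) (x ∷ xs) v w = cong (F v w y x ∧_) (joined-flip F ys xs v w)

touch : ∀ {a b} → Fin a × Fin b → Fin a × Fin b → Bool
touch (v , w) (v′ , w′) = (v == v′) ∨ (w == w′)

∨-trueˡ : ∀ {p q} → p ≡ true → p ∨ q ≡ true
∨-trueˡ refl = refl

∨-trueʳ : ∀ p {q} → q ≡ true → p ∨ q ≡ true
∨-trueʳ true  refl = refl
∨-trueʳ false refl = refl

matching-zip : ∀ {a b n} (as : Vec (Fin a) n) (bs : Vec (Fin b) n) → indep touch (zip as bs) ≡ true →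
               distinct as ≡ true × distinct bs ≡ true
matching-zip []       []       h = refl , refl
matching-zip (a ∷ as) (b ∷ bs) h with ∧-split {avoids touch (a , b) (zip as bs)} h
... | fresh , rest with matching-zip as bs rest
... | ad , bd = ∧-true (≢⇒avoids a as (λ i e → clash i (∨-trueˡ (≡⇒== a _ e)))) ad
              , ∧-true (≢⇒avoids b bs (λ i e → clash i (∨-trueʳ (a == lookup as i) (≡⇒== b _ e)))) bd
  where
  clash : ∀ i → touch (a , b) (lookup as i , lookup bs i) ≡ true → ⊥
  clash i e = true≢false e (not-true (every-zip as bs fresh i))

module _ {a b : ℕ} (p : Fin a → Fin b → Bool) (r : ℕ)
         (rows : ∀ v → rowSum p v ≤ r) (cols : ∀ w → colSum p w ≤ r) where

  private
    cells = cartesianProduct (allFin a) (allFin b)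

  few-touching : ∀ c → ∑ cells (λ d → ⟦ uncurry p d ∧ touch d c ⟧) ≤ r + r
  few-touching (v , w) = begin
    ∑ cells (λ d → ⟦ uncurry p d ∧ touch d (v , w) ⟧)
      ≡⟨ ∑-cartesian (allFin a) (allFin b) _ ⟩
    ∑ (allFin a) (λ y → ∑ (allFin b) (λ x → ⟦ p y x ∧ ((y == v) ∨ (x == w)) ⟧))
      ≤⟨ ∑-mono (allFin a) (λ y → ∑-mono (allFin b) (λ x → split (p y x) (y == v) (x == w))) ⟩
    ∑ (allFin a) (λ y → ∑ (allFin b) (λ x → ⟦ y == v ⟧ * ⟦ p y x ⟧ + ⟦ x == w ⟧ * ⟦ p y x ⟧))
      ≡⟨ ∑-cong (allFin a) (λ y → trans (∑-+ (allFin b) _ _)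
           (cong₂ _+_ (∑-* (allFin b) ⟦ y == v ⟧ _) (∑-delta w (λ x → ⟦ p y x ⟧)))) ⟩
    ∑ (allFin a) (λ y → ⟦ y == v ⟧ * rowSum p y + ⟦ p y w ⟧)
      ≡⟨ trans (∑-+ (allFin a) _ _) (cong (_+ colSum p w) (∑-delta v (rowSum p))) ⟩
    rowSum p v + colSum p w
      ≤⟨ +-mono-≤ (rows v) (cols w) ⟩
    r + r ∎
    where
    open ≤-Reasoning
    split : ∀ c d e → ⟦ c ∧ (d ∨ e) ⟧ ≤ ⟦ d ⟧ * ⟦ c ⟧ + ⟦ e ⟧ * ⟦ c ⟧
    split false d     e     = z≤n
    split true  true  e     = s≤s z≤n
    split true  false true  = ≤-refl
    split true  false false = z≤n

  ∑-cells : ∑ cells (⟦_⟧ ∘ uncurry p) ≡ size p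
  ∑-cells = ∑-cartesian (allFin a) (allFin b) _

  pick-matching : ∀ n → n * (r + r) < size p →
                  ∃ λ (cs : Vec (Fin a × Fin b) n) → every (uncurry p) cs ≡ true × indep touch cs ≡ true
  pick-matching n h = pick-indep cells (uncurry p) touch (r + r) few-touching n
                        (≤-trans h (≤-reflexive (sym ∑-cells)))

  ∑-matching : ∀ n → (size p ∸ n * (r + r)) ^ n
               ≤ ∑ (vecs n cells) (λ cs → ⟦ every (uncurry p) cs ∧ indep touch cs ⟧)
  ∑-matching n = subst (λ s → (s ∸ n * (r + r)) ^ n ≤ ∑ (vecs n cells) (λ cs → ⟦ every (uncurry p) cs ∧ indep touch cs ⟧))
                   ∑-cells (∑-indep cells (uncurry p) touch (r + r) few-touching n n ≤-refl)

module _ {a b t′ : ℕ} {M : Matrix a b} (free : ¬ Pattern (suc t′) M)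
         {Δ Θ : ℕ} .{{_ : NonZero Δ}} .{{_ : NonZero Θ}}
         {F : Fin a → Fin b → Matrix a b} (family : IsFamily M Θ F)
         (rows : ∀ v → rowSum M v ≤ Δ) (cols : ∀ w → colSum M w ≤ Δ) where
  open IsFamily family

  private
    t = suc t′
    Ys = Vec (Fin a) t
    Xs = Vec (Fin b) t
    L₁ = vecs t (allFin a)
    L₂ = vecs t (allFin b)
    F′ : Fin b → Fin a → Matrix b a
    F′ w v x y = F v w y x
    starR : Ys → Xs → Fin a → Bool
    starR ys xs v = star F ys xs t v
    starC : Ys → Xs → Fin b → Bool
    starC ys xs w = star F′ xs ys t w
    cap = t * (t + t + (t + t))

    module _ (ys : Ys) (xs : Xs) (nd : distinct ys ∧ distinct xs ≡ true) where
      J = joined F ys xs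

      yd : distinct ys ≡ true
      yd = proj₁ (∧-split nd)
      xd : distinct xs ≡ true
      xd = proj₂ (∧-split {distinct ys} nd)

      light : Fin a → Fin b → Bool
      light v w = J v w ∧ (not (t + t ≤ᵇ rowSum J v) ∧ not (t + t ≤ᵇ colSum J w))

      light⇒J : ∀ v w → light v w ≡ true → J v w ≡ true
      light⇒J v w h = proj₁ (∧-split h)

      light-row : ∀ v → rowSum light v ≤ t + t
      light-row v = ≤-trans
        (∑-guard (allFin b) (light v) (not (t + t ≤ᵇ rowSum J v)) {t + t}
          (λ w h → proj₁ (∧-split (proj₂ (∧-split {J v w} h))))
          (λ g → ≤-trans (∑-mono (allFin b) (λ w → ⟦⟧-mono (light v w) (J v w) (light⇒J v w)))
                         (<⇒≤ (≤ᵇ-false⇒> (t + t) (rowSum J v) (not-true g)))))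
        (≤-trans (*-monoˡ-≤ (t + t) (⟦⟧≤1 (not (t + t ≤ᵇ rowSum J v)))) (≤-reflexive (*-identityˡ (t + t))))

      light-col : ∀ w → colSum light w ≤ t + t
      light-col w = ≤-trans
        (∑-guard (allFin a) (λ v → light v w) (not (t + t ≤ᵇ colSum J w)) {t + t}
          (λ v h → proj₂ (∧-split {not (t + t ≤ᵇ rowSum J v)} (proj₂ (∧-split {J v w} h))))
          (λ g → ≤-trans (∑-mono (allFin a) (λ v → ⟦⟧-mono (light v w) (J v w) (light⇒J v w)))
                         (<⇒≤ (≤ᵇ-false⇒> (t + t) (colSum J w) (not-true g)))))
        (≤-trans (*-monoˡ-≤ (t + t) (⟦⟧≤1 (not (t + t ≤ᵇ colSum J w)))) (≤-reflexive (*-identityˡ (t + t))))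

      -- All degrees in `light` are at most 2t, so more than t · 4t cells would contain a
      -- t-matching, which together with `ys` and `xs` is a copy of H.
      few-light : size light ≤ cap
      few-light = ≮⇒≥ λ many →
        let cs , all , m = pick-matching light (t + t) light-row light-col t many
            cyc = λ i j → cycle _ _ _ _ (joined-lookup F ys xs _ _ (light⇒J _ _ (every-lookup cs all j)) i)
        in free (record
          { R = lookup ys ; S = proj₁ ∘ lookup cs ; P = lookup xs ; Q = proj₂ ∘ lookup cs
          ; R-inj = distinct⇒injective ys yd
          ; S-inj = indep⇒injective proj₁ (λ c d e → ∨-trueˡ (≡⇒== (proj₁ c) (proj₁ d) e)) cs m
          ; P-inj = distinct⇒injective xs xd
          ; Q-inj = indep⇒injective proj₂ (λ c d e → ∨-trueʳ (proj₁ c == proj₁ d) (≡⇒== (proj₂ c) (proj₂ d) e)) cs m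
          ; R≢S = λ i j → FourCycle.y≢v (proj₂ (cyc i j))
          ; P≢Q = λ i j → FourCycle.x≢w (proj₂ (cyc i j))
          ; RQ = λ i j → FourCycle.yw (proj₂ (cyc i j))
          ; SP = λ i j → FourCycle.vx (proj₂ (cyc j i))
          ; RP = λ i → FourCycle.yx (proj₂ (cyc i i))
          ; SQ = λ i → proj₁ (cyc i i) })

      -- Without the guard, summing over all pairs of tuples would give (ab)^t in place of
      -- `size M ^ t`.
      light-guard : size light ≤ cap * ⟦ every (uncurry M) (zip ys xs) ⟧
      light-guard with every (uncurry M) (zip ys xs) in eq
      ... | true  = ≤-trans few-light (≤-reflexive (sym (*-identityʳ cap)))
      ... | false = ≤-trans (≤-reflexive (∑-zero (allFin a) (λ v → ∑-zero (allFin b) (empty v)))) z≤n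
        where
        empty : ∀ v w → ⟦ light v w ⟧ ≡ 0
        empty v w = n≤0⇒n≡0 (⟦⟧-≤ (light v w) λ h → ⊥-elim (true≢false
          (zip-every {q = uncurry M} ys xs (λ i → FourCycle.yx (proj₂ (cycle _ _ _ _
            (joined-lookup F ys xs v w (light⇒J v w h) i))))) eq))

      colSum-J : ∀ w → colSum J w ≡ rowSum (joined F′ xs ys) w
      colSum-J w = ∑-cong (allFin a) (λ v → cong ⟦_⟧ (sym (joined-flip F ys xs v w)))

      size-J : size J ≤ cap * ⟦ every (uncurry M) (zip ys xs) ⟧
               + (∑ (allFin a) (λ v → ⟦ starR ys xs v ⟧ * rowSum J v)
               + ∑ (allFin b) (λ w → ⟦ starC ys xs w ⟧ * rowSum (joined F′ xs ys) w))
      size-J = begin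
        size J
          ≤⟨ ∑-mono (allFin a) (λ v → ∑-mono (allFin b) (λ w →
               split (J v w) (t + t ≤ᵇ rowSum J v) (t + t ≤ᵇ colSum J w))) ⟩
        ∑ (allFin a) (λ v → ∑ (allFin b) (λ w → ⟦ light v w ⟧ +
          (⟦ t + t ≤ᵇ rowSum J v ⟧ * ⟦ J v w ⟧ + ⟦ t + t ≤ᵇ colSum J w ⟧ * ⟦ J v w ⟧)))
          ≡⟨ trans (∑∑-+ _ _) (cong (size light +_) (∑∑-+ _ _)) ⟩
        size light + (∑ (allFin a) (λ v → ∑ (allFin b) (λ w → ⟦ t + t ≤ᵇ rowSum J v ⟧ * ⟦ J v w ⟧))
          + ∑ (allFin a) (λ v → ∑ (allFin b) (λ w → ⟦ t + t ≤ᵇ colSum J w ⟧ * ⟦ J v w ⟧)))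
          ≡⟨ cong (size light +_) (cong₂ _+_ (∑-cong (allFin a) row-part)
               (trans (∑-swap (allFin a) (allFin b) _) (∑-cong (allFin b) col-part))) ⟩
        size light + (∑ (allFin a) (λ v → ⟦ starR ys xs v ⟧ * rowSum J v)
               + ∑ (allFin b) (λ w → ⟦ starC ys xs w ⟧ * rowSum (joined F′ xs ys) w))
          ≤⟨ +-monoˡ-≤ _ light-guard ⟩
        cap * ⟦ every (uncurry M) (zip ys xs) ⟧ + (∑ (allFin a) (λ v → ⟦ starR ys xs v ⟧ * rowSum J v)
               + ∑ (allFin b) (λ w → ⟦ starC ys xs w ⟧ * rowSum (joined F′ xs ys) w)) ∎
        where
        open ≤-Reasoning
        ∑∑-+ : ∀ (f g : Fin a → Fin b → ℕ) → ∑ (allFin a) (λ v → ∑ (allFin b) (λ w → f v w + g v w))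
               ≡ ∑ (allFin a) (λ v → ∑ (allFin b) (f v)) + ∑ (allFin a) (λ v → ∑ (allFin b) (g v))
        ∑∑-+ f g = trans (∑-cong (allFin a) (λ v → ∑-+ (allFin b) (f v) (g v))) (∑-+ (allFin a) _ _)
        split : ∀ j r c → ⟦ j ⟧ ≤ ⟦ j ∧ (not r ∧ not c) ⟧ + (⟦ r ⟧ * ⟦ j ⟧ + ⟦ c ⟧ * ⟦ j ⟧)
        split false r     c     = z≤n
        split true  true  c     = s≤s z≤n
        split true  false true  = ≤-refl
        split true  false false = ≤-refl
        row-part : ∀ v → ∑ (allFin b) (λ w → ⟦ t + t ≤ᵇ rowSum J v ⟧ * ⟦ J v w ⟧) ≡ ⟦ starR ys xs v ⟧ * rowSum J v
        row-part v rewrite yd | xd = ∑-* (allFin b) ⟦ t + t ≤ᵇ rowSum J v ⟧ _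
        col-part : ∀ w → ∑ (allFin a) (λ v → ⟦ t + t ≤ᵇ colSum J w ⟧ * ⟦ J v w ⟧)
                   ≡ ⟦ starC ys xs w ⟧ * rowSum (joined F′ xs ys) w
        col-part w rewrite yd | xd | sym (colSum-J w) = ∑-* (allFin a) ⟦ t + t ≤ᵇ colSum J w ⟧ _

  -- Double counting pairs of an edge v w and a t-matching all of whose edges span with it a cycle of the family.
  matching-count : ∑ (allFin a) (λ v → ∑ (allFin b) (λ w → (size (F v w) ∸ t * (Θ + Θ)) ^ t))
                   ≤ t * (t + t + (t + t)) * size M ^ t + 2 * (4 * t * Δ ^ t′ * Θ * (size M * Δ ^ t′))
  matching-count = begin
    ∑ (allFin a) (λ v → ∑ (allFin b) (λ w → (size (F v w) ∸ t * (Θ + Θ)) ^ t))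
      ≤⟨ ∑-mono (allFin a) (λ v → ∑-mono (allFin b) (λ w → per-edge v w)) ⟩
    ∑ (allFin a) (λ v → ∑ (allFin b) (λ w → ∑ L₁ (λ ys → ∑ L₂ (λ xs → ⟦ nd ys xs ⟧ * ⟦ joined F ys xs v w ⟧))))
      ≡⟨ reorder ⟩
    ∑ L₁ (λ ys → ∑ L₂ (λ xs → ⟦ nd ys xs ⟧ * size (joined F ys xs)))
      ≤⟨ ∑-mono L₁ (λ ys → ∑-mono L₂ (λ xs → ⟦⟧*-≤ (nd ys xs) (size-J ys xs))) ⟩
    ∑ L₁ (λ ys → ∑ L₂ (λ xs → cap * E ys xs + (row-stars ys xs + col-stars ys xs)))
      ≡⟨ trans (∑∑-+ _ _) (cong₂ _+_ (trans (∑-cong L₁ (λ ys → ∑-* L₂ cap (E ys))) (∑-* L₁ cap _)) (∑∑-+ row-stars col-stars)) ⟩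
    cap * ∑ L₁ (λ ys → ∑ L₂ (E ys)) + (∑ L₁ (λ ys → ∑ L₂ (row-stars ys)) + ∑ L₁ (λ ys → ∑ L₂ (col-stars ys)))
      ≤⟨ +-mono-≤ (≤-reflexive (cong (cap *_) edges)) (+-mono-≤ (total-stars free family rows cols) stars-B) ⟩
    cap * size M ^ t + (X + X)
      ≡⟨ cong (cap * size M ^ t +_) (cong (X +_) (sym (+-identityʳ X))) ⟩
    cap * size M ^ t + 2 * X ∎
    where
    open ≤-Reasoning
    X = 4 * t * Δ ^ t′ * Θ * (size M * Δ ^ t′)
    nd : Ys → Xs → Bool
    nd ys xs = distinct ys ∧ distinct xs
    E row-stars col-stars : Ys → Xs → ℕ
    E ys xs = ⟦ every (uncurry M) (zip ys xs) ⟧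
    row-stars ys xs = ∑ (allFin a) (λ v → ⟦ starR ys xs v ⟧ * rowSum (joined F ys xs) v)
    col-stars ys xs = ∑ (allFin b) (λ w → ⟦ starC ys xs w ⟧ * rowSum (joined F′ xs ys) w)
    ∑∑-+ : ∀ (f g : Ys → Xs → ℕ) → ∑ L₁ (λ ys → ∑ L₂ (λ xs → f ys xs + g ys xs))
           ≡ ∑ L₁ (λ ys → ∑ L₂ (f ys)) + ∑ L₁ (λ ys → ∑ L₂ (g ys))
    ∑∑-+ f g = trans (∑-cong L₁ (λ ys → ∑-+ L₂ (f ys) (g ys))) (∑-+ L₁ _ _)
    -- `F v w` has maximum degree at most Θ, so a chosen cell rules out at most 2Θ cells for the
    -- rest of the matching.
    per-edge : ∀ v w → (size (F v w) ∸ t * (Θ + Θ)) ^ t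
               ≤ ∑ L₁ (λ ys → ∑ L₂ (λ xs → ⟦ nd ys xs ⟧ * ⟦ joined F ys xs v w ⟧))
    per-edge v w = begin
      (size (F v w) ∸ t * (Θ + Θ)) ^ t
        ≤⟨ ∑-matching (F v w) Θ (rows≤ v w) (cols≤ v w) t ⟩
      ∑ (vecs t (cartesianProduct (allFin a) (allFin b))) (λ cs → ⟦ every (uncurry (F v w)) cs ∧ indep touch cs ⟧)
        ≡⟨ ∑-vecs-zip t (allFin a) (allFin b) _ ⟩
      ∑ L₁ (λ ys → ∑ L₂ (λ xs → ⟦ joined F ys xs v w ∧ indep touch (zip ys xs) ⟧))
        ≤⟨ ∑-mono L₁ (λ ys → ∑-mono L₂ (λ xs → ≤-trans
             (⟦⟧-mono (joined F ys xs v w ∧ indep touch (zip ys xs)) (nd ys xs ∧ joined F ys xs v w)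
               (λ h → let j , i = ∧-split {joined F ys xs v w} h ; yd , xd = matching-zip ys xs i in ∧-true (∧-true yd xd) j))
             (≤-reflexive (⟦∧⟧ (nd ys xs) _)))) ⟩
      ∑ L₁ (λ ys → ∑ L₂ (λ xs → ⟦ nd ys xs ⟧ * ⟦ joined F ys xs v w ⟧)) ∎
    G : Fin a → Fin b → Ys → Xs → ℕ
    G v w ys xs = ⟦ nd ys xs ⟧ * ⟦ joined F ys xs v w ⟧
    reorder : ∑ (allFin a) (λ v → ∑ (allFin b) (λ w → ∑ L₁ (λ ys → ∑ L₂ (G v w ys))))
              ≡ ∑ L₁ (λ ys → ∑ L₂ (λ xs → ⟦ nd ys xs ⟧ * size (joined F ys xs)))
    reorder =
      trans (∑-cong (allFin a) (λ v → trans (∑-swap (allFin b) L₁ (λ w ys → ∑ L₂ (G v w ys)))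
                                            (∑-cong L₁ (λ ys → ∑-swap (allFin b) L₂ (λ w xs → G v w ys xs)))))
      (trans (∑-swap (allFin a) L₁ (λ v ys → ∑ L₂ (λ xs → ∑ (allFin b) (λ w → G v w ys xs))))
      (∑-cong L₁ (λ ys → trans (∑-swap (allFin a) L₂ (λ v xs → ∑ (allFin b) (λ w → G v w ys xs)))
        (∑-cong L₂ (λ xs → trans (∑-cong (allFin a) (λ v → ∑-* (allFin b) ⟦ nd ys xs ⟧ _))
                                 (∑-* (allFin a) ⟦ nd ys xs ⟧ _))))))
    edges : ∑ L₁ (λ ys → ∑ L₂ (E ys)) ≡ size M ^ t
    edges = trans (sym (∑-vecs-zip t (allFin a) (allFin b) (λ cs → ⟦ every (uncurry M) cs ⟧)))
            (trans (∑-every t (cartesianProduct (allFin a) (allFin b)) (uncurry M))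
                   (cong (_^ t) (∑-cartesian (allFin a) (allFin b) _)))
    stars-B : ∑ L₁ (λ ys → ∑ L₂ (col-stars ys)) ≤ X
    stars-B = ≤-trans (≤-reflexive (∑-swap L₁ L₂ col-stars))
      (≤-trans (total-stars (free ∘ transpose-pattern) (flip-family family) cols rows)
               (≤-reflexive (cong (λ s → 4 * t * Δ ^ t′ * Θ * (s * Δ ^ t′)) (size-flip M))))

-- Closed walks of length four, and the bound on the number of edges

∑-product : ∀ {A B : Set} (L : List A) (K : List B) (f : A → ℕ) (g : B → ℕ) →
            ∑ L (λ i → ∑ K (λ l → f i * g l)) ≡ ∑ L f * ∑ K g
∑-product L K f g = begin
  ∑ L (λ i → ∑ K (λ l → f i * g l))  ≡⟨ ∑-cong L (λ i → trans (∑-* K (f i) g) (*-comm (f i) (∑ K g))) ⟩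
  ∑ L (λ i → ∑ K g * f i)            ≡⟨ ∑-* L (∑ K g) f ⟩
  ∑ K g * ∑ L f                      ≡⟨ *-comm (∑ K g) (∑ L f) ⟩
  ∑ L f * ∑ K g                      ∎
  where open ≡-Reasoning

-- The C₄ case of Sidorenko's inequality. Cauchy-Schwarz over columns bounds the sum `P` of the
-- codegrees from below, and two more applications over rows bound the sum `Q` of their squares,
-- which counts closed walks.
four-walks : ∀ {a b} (M : Matrix a b) →
             size M ^ 4 ≤ (a * b) ^ 2 * ∑ (allFin a) (λ v → ∑ (allFin b) (λ w → ⟦ M v w ⟧ * size (walk M v w)))
four-walks {a} {b} M = begin
  size M ^ 4                         ≡⟨ square² (size M) ⟩
  (size M * size M) * (size M * size M)
    ≤⟨ *-mono-≤ square square ⟩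
  (b * P) * (b * P)                  ≡⟨ regroup₁ b P ⟩
  b * b * (P * P)                    ≤⟨ *-monoʳ-≤ (b * b) P² ⟩
  b * b * (a * (a * Q))              ≡⟨ regroup₂ a b Q ⟩
  (a * b) ^ 2 * Q                    ≡⟨ cong ((a * b) ^ 2 *_) Q≡ ⟩
  (a * b) ^ 2 * ∑ (allFin a) (λ v → ∑ (allFin b) (λ w → ⟦ M v w ⟧ * size (walk M v w))) ∎
  where
  open ≤-Reasoning
  square² : ∀ e → e ^ 4 ≡ (e * e) * (e * e)
  square² e = expand e
    where
    expand : ∀ e → e * (e * (e * (e * 1))) ≡ (e * e) * (e * e)
    expand = solve-∀
  regroup₁ : ∀ b p → (b * p) * (b * p) ≡ b * b * (p * p)
  regroup₁ = solve-∀
  regroup₂ : ∀ a b q → b * b * (a * (a * q)) ≡ a * b * (a * b * 1) * q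
  regroup₂ = solve-∀
  codeg : Fin a → Fin a → ℕ
  codeg v y = ∑ (allFin b) (λ w → ⟦ M v w ⟧ * ⟦ M y w ⟧)
  P = ∑ (allFin a) (λ v → ∑ (allFin a) (codeg v))
  Q = ∑ (allFin a) (λ v → ∑ (allFin a) (λ y → codeg v y * codeg v y))
  square : size M * size M ≤ b * P
  square = begin
    size M * size M                   ≡⟨ cong₂ _*_ (size-flip M) (size-flip M) ⟨
    ∑ (allFin b) (colSum M) * ∑ (allFin b) (colSum M)
      ≤⟨ cauchy-schwarz (allFin b) (colSum M) ⟩
    length (allFin b) * ∑ (allFin b) (λ w → colSum M w * colSum M w)
      ≡⟨ cong₂ _*_ (length-allFin b) (trans
           (∑-cong (allFin b) (λ w → sym (∑-product (allFin a) (allFin a) (λ v → ⟦ M v w ⟧) (λ y → ⟦ M y w ⟧))))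
           (trans (∑-swap (allFin b) (allFin a) _) (∑-cong (allFin a) (λ v → ∑-swap (allFin b) (allFin a) _)))) ⟩
    b * P ∎
  P² : P * P ≤ a * (a * Q)
  P² = begin
    P * P
      ≤⟨ cauchy-schwarz (allFin a) (λ v → ∑ (allFin a) (codeg v)) ⟩
    length (allFin a) * ∑ (allFin a) (λ v → ∑ (allFin a) (codeg v) * ∑ (allFin a) (codeg v))
      ≤⟨ *-monoʳ-≤ (length (allFin a)) (∑-mono (allFin a) (λ v → cauchy-schwarz (allFin a) (codeg v))) ⟩
    length (allFin a) * ∑ (allFin a) (λ v → length (allFin a) * ∑ (allFin a) (λ y → codeg v y * codeg v y))
      ≡⟨ cong (length (allFin a) *_) (∑-* (allFin a) (length (allFin a)) _) ⟩
    length (allFin a) * (length (allFin a) * Q)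
      ≡⟨ cong (λ l → l * (l * Q)) (length-allFin a) ⟩
    a * (a * Q) ∎
  entry : ∀ p q r s → ⟦ p ⟧ * ⟦ q ⟧ * (⟦ r ⟧ * ⟦ s ⟧) ≡ ⟦ p ⟧ * ⟦ q ∧ (r ∧ s) ⟧
  entry false q     r     s = refl
  entry true  false r     s = refl
  entry true  true  false s = refl
  entry true  true  true  s = +-identityʳ _
  Q≡ : Q ≡ ∑ (allFin a) (λ v → ∑ (allFin b) (λ w → ⟦ M v w ⟧ * size (walk M v w)))
  Q≡ = ∑-cong (allFin a) λ v →
    trans (∑-cong (allFin a) (λ y → sym (∑-product (allFin b) (allFin b) (λ w → ⟦ M v w ⟧ * ⟦ M y w ⟧) (λ x → ⟦ M v x ⟧ * ⟦ M y x ⟧))))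
    (trans (∑-swap (allFin a) (allFin b) _)
    (∑-cong (allFin b) (λ w →
      trans (∑-cong (allFin a) (λ y → trans (∑-cong (allFin b) (λ x → entry (M v w) (M y w) (M v x) (M y x)))
                                            (∑-* (allFin b) ⟦ M v w ⟧ _)))
            (∑-* (allFin a) ⟦ M v w ⟧ _))))

module _ {a b t′ : ℕ} {M : Matrix a b} (free : ¬ Pattern (suc t′) M)
         {Δ Θ Z : ℕ} .{{_ : NonZero Δ}} .{{_ : NonZero Θ}} .{{_ : NonZero Z}}
         (rows : ∀ v → rowSum M v ≤ Δ) (cols : ∀ w → colSum M w ≤ Δ)
         (Θ-large : suc (t′ + t′) * (2 * Δ) ^ suc (t′ + t′) ≤ Δ * Θ ^ suc (t′ + t′))
         (Z-large : suc t′ * (suc t′ + suc t′ + (suc t′ + suc t′)) * size M ^ suc t′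
                    + 2 * (4 * suc t′ * Δ ^ t′ * Θ * (size M * Δ ^ t′)) ≤ size M * Z ^ suc t′)
         (lower-order : 3 * (suc t′ * (Θ + Θ)) + 2 * (suc t′ + suc t′) * Δ ≤ 2 * Z) where

  private
    t E : ℕ
    t = suc t′
    E = size M

    open module Fam v w = CycleFamily (cycle-family {t = t} {k = t′ + t′} free (cong suc (sym (+-suc t′ t′))) Θ-large rows cols v w)

    family : IsFamily M Θ C
    family = record { cycle = cycle ; rows≤ = rows≤ ; cols≤ = cols≤ }

    D z : Fin a → Fin b → ℕ
    D v w = size (C v w)
    z v w = D v w ∸ t * (Θ + Θ)

    ∑∑ : (Fin a → Fin b → ℕ) → ℕ
    ∑∑ f = ∑ (allFin a) (λ v → ∑ (allFin b) (f v))
    ∑∑-+ : ∀ f g → ∑∑ (λ y x → f y x + g y x) ≡ ∑∑ f + ∑∑ g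
    ∑∑-+ f g = trans (∑-cong (allFin a) (λ y → ∑-+ (allFin b) (f y) (g y))) (∑-+ (allFin a) _ _)
    ∑∑-* : ∀ c f → ∑∑ (λ y x → c * f y x) ≡ c * ∑∑ f
    ∑∑-* c f = trans (∑-cong (allFin a) (λ y → ∑-* (allFin b) c (f y))) (∑-* (allFin a) c _)
    ∑∑-mono : ∀ {f g} → (∀ y x → f y x ≤ g y x) → ∑∑ f ≤ ∑∑ g
    ∑∑-mono h = ∑-mono (allFin a) (λ y → ∑-mono (allFin b) (h y))

    D-guard : ∀ v w → D v w ≤ ⟦ M v w ⟧ * D v w
    D-guard v w = guarded (M v w) (λ h → n≤0⇒n≡0 (≤-reflexive (∑-zero (allFin a) (λ y → ∑-zero (allFin b) (λ x →
      n≤0⇒n≡0 (⟦⟧-≤ (C v w y x) (λ c → ⊥-elim (true≢false (proj₁ (cycle v w y x c)) h))))))))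
      where
      guarded : ∀ c {n} → (c ≡ false → n ≡ 0) → n ≤ ⟦ c ⟧ * n
      guarded true  h = ≤-reflexive (sym (+-identityʳ _))
      guarded false h = ≤-reflexive (h refl)

    D≤ : ∀ v w → D v w ≤ z v w + t * (Θ + Θ) * ⟦ M v w ⟧
    D≤ v w = ≤-trans (D-guard v w) (bound (M v w))
      where
      bound : ∀ c → ⟦ c ⟧ * D v w ≤ z v w + t * (Θ + Θ) * ⟦ c ⟧
      bound true  = begin
        D v w + 0                          ≡⟨ +-identityʳ (D v w) ⟩
        D v w                              ≤⟨ m≤n+m∸n (D v w) (t * (Θ + Θ)) ⟩
        t * (Θ + Θ) + z v w                ≡⟨ +-comm (t * (Θ + Θ)) (z v w) ⟩
        z v w + t * (Θ + Θ)                ≡⟨ cong (z v w +_) (sym (*-identityʳ (t * (Θ + Θ)))) ⟩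
        z v w + t * (Θ + Θ) * 1            ∎
        where open ≤-Reasoning
      bound false = z≤n

    z-guard : ∀ v w → z v w ≤ ⟦ M v w ⟧ * z v w
    z-guard v w = ≤-trans (∸-monoˡ-≤ (t * (Θ + Θ)) (D-guard v w)) (guarded (M v w))
      where
      guarded : ∀ c → ⟦ c ⟧ * D v w ∸ t * (Θ + Θ) ≤ ⟦ c ⟧ * z v w
      guarded true  = ≤-reflexive (trans (cong (_∸ t * (Θ + Θ)) (+-identityʳ (D v w))) (sym (+-identityʳ _)))
      guarded false = ≤-reflexive (0∸n≡0 (t * (Θ + Θ)))

    pointwise : ∀ v w → Z ^ t′ * z v w ≤ Z ^ t * ⟦ M v w ⟧ + z v w ^ t
    pointwise v w = bound (M v w) (z-guard v w)
      where
      bound : ∀ c {n} → n ≤ ⟦ c ⟧ * n → Z ^ t′ * n ≤ Z ^ t * ⟦ c ⟧ + n ^ t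
      bound true {n} _ = begin
        Z ^ t′ * n            ≡⟨ *-comm (Z ^ t′) n ⟩
        n * Z ^ t′            ≤⟨ young t′ n Z ⟩
        Z ^ t + n ^ t         ≡⟨ cong (_+ n ^ t) (sym (*-identityʳ (Z ^ t))) ⟩
        Z ^ t * 1 + n ^ t     ∎
        where open ≤-Reasoning
      bound false z≤n = ≤-trans (≤-reflexive (*-zeroʳ (Z ^ t′))) z≤n

    ∑z : ∑∑ z ≤ 2 * (E * Z)
    ∑z = *-cancelˡ-≤ (Z ^ t′) {{m^n≢0 Z t′}} (begin
      Z ^ t′ * ∑∑ z                          ≡⟨ ∑∑-* (Z ^ t′) z ⟨
      ∑∑ (λ v w → Z ^ t′ * z v w)            ≤⟨ ∑∑-mono pointwise ⟩
      ∑∑ (λ v w → Z ^ t * ⟦ M v w ⟧ + z v w ^ t)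
        ≡⟨ trans (∑∑-+ _ _) (cong (_+ ∑∑ (λ v w → z v w ^ t)) (∑∑-* (Z ^ t) _)) ⟩
      Z ^ t * E + ∑∑ (λ v w → z v w ^ t)     ≤⟨ +-monoʳ-≤ (Z ^ t * E) (≤-trans (matching-count free family rows cols) Z-large) ⟩
      Z * Z ^ t′ * E + E * (Z * Z ^ t′)      ≡⟨ regroup Z (Z ^ t′) E ⟩
      Z ^ t′ * (2 * (E * Z))                 ∎)
      where
      open ≤-Reasoning
      regroup : ∀ z p e → z * p * e + e * (z * p) ≡ p * (2 * (e * z))
      regroup = solve-∀

  -- By `young` with threshold Z, the family cycles in excess of 2tΘ per edge number at most 2EZ
  -- altogether. The factor 3 of `large` makes this 6EZ, and `lower-order` fits the remaining terms
  -- in Θ and Δ into another 2EZ.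
  size-bound : size M ^ 4 ≤ (a * b) ^ 2 * (8 * (size M * Z))
  size-bound = ≤-trans (four-walks M) (*-monoʳ-≤ ((a * b) ^ 2) (begin
    ∑∑ (λ v w → ⟦ M v w ⟧ * size (walk M v w))
      ≤⟨ ∑∑-mono large ⟩
    ∑∑ (λ v w → 3 * D v w + ⟦ M v w ⟧ * (2 * (t + t) * Δ))
      ≤⟨ ∑∑-mono (λ v w → +-mono-≤ (*-monoʳ-≤ 3 (D≤ v w)) (≤-reflexive (*-comm ⟦ M v w ⟧ _))) ⟩
    ∑∑ (λ v w → 3 * (z v w + t * (Θ + Θ) * ⟦ M v w ⟧) + 2 * (t + t) * Δ * ⟦ M v w ⟧)
      ≡⟨ trans (∑∑-+ _ _) (cong₂ _+_
           (trans (∑∑-* 3 _) (cong (3 *_) (trans (∑∑-+ _ _) (cong (∑∑ z +_) (∑∑-* (t * (Θ + Θ)) _)))))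
           (∑∑-* (2 * (t + t) * Δ) _)) ⟩
    3 * (∑∑ z + t * (Θ + Θ) * E) + 2 * (t + t) * Δ * E
      ≤⟨ +-monoˡ-≤ _ (*-monoʳ-≤ 3 (+-monoˡ-≤ _ ∑z)) ⟩
    3 * (2 * (E * Z) + t * (Θ + Θ) * E) + 2 * (t + t) * Δ * E
      ≡⟨ regroup₁ (E * Z) (t * (Θ + Θ)) (2 * (t + t) * Δ) E ⟩
    6 * (E * Z) + (3 * (t * (Θ + Θ)) + 2 * (t + t) * Δ) * E
      ≤⟨ +-monoʳ-≤ (6 * (E * Z)) (*-monoˡ-≤ E lower-order) ⟩
    6 * (E * Z) + 2 * Z * E
      ≡⟨ regroup₂ E Z ⟩
    8 * (E * Z) ∎))
    where
    open ≤-Reasoning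
    regroup₁ : ∀ p q r e → 3 * (2 * p + q * e) + r * e ≡ 6 * p + (3 * q + r) * e
    regroup₁ = solve-∀
    regroup₂ : ∀ e z → 6 * (e * z) + 2 * z * e ≡ 8 * (e * z)
    regroup₂ = solve-∀

-- Splitting vertices to bound the degrees

subset-of-size : ∀ {n} (f : Fin n → Bool) d → d ≤ ∑ (allFin n) (⟦_⟧ ∘ f) →
                 ∃ λ (g : Fin n → Bool) → (∀ i → g i ≡ true → f i ≡ true) × ∑ (allFin n) (⟦_⟧ ∘ g) ≡ d
subset-of-size {n} f zero h = (λ _ → false) , (λ _ ()) , ∑-zero (allFin n) (λ _ → refl)
subset-of-size {zero} f (suc d) ()
subset-of-size {suc n} f (suc d) h = by (f zero) refl
  where
  tail : ∀ {c} → f zero ≡ c → suc d ≤ ⟦ c ⟧ + ∑ (allFin n) (⟦_⟧ ∘ f ∘ suc)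
  tail refl = ≤-trans h (≤-reflexive (∑-allFin-suc (⟦_⟧ ∘ f)))
  cons : Bool → (Fin n → Bool) → Fin (suc n) → Bool
  cons c g zero    = c
  cons c g (suc i) = g i
  extend : ∀ c {m} → (c ≡ true → f zero ≡ true) →
           (∃ λ (g : Fin n → Bool) → (∀ i → g i ≡ true → f (suc i) ≡ true) × ∑ (allFin n) (⟦_⟧ ∘ g) ≡ m) →
           ∃ λ (g : Fin (suc n) → Bool) → (∀ i → g i ≡ true → f i ≡ true) × ∑ (allFin (suc n)) (⟦_⟧ ∘ g) ≡ ⟦ c ⟧ + m
  extend c h₀ (g , g⊆f , size-g) = cons c g , (λ { zero → h₀ ; (suc i) → g⊆f i }) ,
    trans (∑-allFin-suc (⟦_⟧ ∘ cons c g)) (cong (⟦ c ⟧ +_) size-g)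
  by : ∀ c → f zero ≡ c → ∃ λ (g : Fin (suc n) → Bool) → (∀ i → g i ≡ true → f i ≡ true) × ∑ (allFin (suc n)) (⟦_⟧ ∘ g) ≡ suc d
  by true  e = extend true (λ _ → e) (subset-of-size (f ∘ suc) d (s≤s⁻¹ (tail e)))
  by false e = extend false (λ ()) (subset-of-size (f ∘ suc) (suc d) (tail e))

-- Any two vertices of H_{t,t} in the same class have a common neighbour, so π may identify only rows with disjoint supports.
project-pattern : ∀ {a a′ b t′} {M : Matrix a b} {M′ : Matrix a′ b} (π : Fin a′ → Fin a) →
                  (∀ r c → M′ r c ≡ true → M (π r) c ≡ true) →
                  (∀ r s c → M′ r c ≡ true → M′ s c ≡ true → π r ≡ π s → r ≡ s) →
                  Pattern (suc t′) M′ → Pattern (suc t′) M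
project-pattern π hom inj p = record
  { R = π ∘ R ; S = π ∘ S ; P = P ; Q = Q ; P-inj = P-inj ; Q-inj = Q-inj ; P≢Q = P≢Q
  ; R-inj = λ {i} {j} → R-inj ∘ inj (R i) (R j) (Q zero) (RQ i zero) (RQ j zero)
  ; S-inj = λ {i} {j} → S-inj ∘ inj (S i) (S j) (P zero) (SP i zero) (SP j zero)
  ; R≢S = λ i j → R≢S i j ∘ inj (R i) (S j) (P i) (RP i) (SP j i)
  ; RQ = λ i j → hom _ _ (RQ i j) ; SP = λ i j → hom _ _ (SP i j)
  ; RP = λ i → hom _ _ (RP i) ; SQ = λ i → hom _ _ (SQ i) }
  where open Pattern p

module _ {a b : ℕ} (M : Matrix a b) (u : Fin a) (S : Fin b → Bool) (S⊆ : ∀ c → S c ≡ true → M u c ≡ true) where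

  splitRow : Matrix (suc a) b
  splitRow zero    c = S c
  splitRow (suc v) c = M v c ∧ not ((v == u) ∧ S c)

  private
    merge : Fin (suc a) → Fin a
    merge zero    = u
    merge (suc v) = v

    clash : ∀ v c → S c ≡ true → splitRow (suc v) c ≡ true → u ≢ v
    clash v c s h refl = true≢false (∧-true (==-refl u) s) (not-true (proj₂ (∧-split {M u c} h)))

  split-pattern : ∀ {t′} → Pattern (suc t′) splitRow → Pattern (suc t′) M
  split-pattern = project-pattern merge
    (λ { zero c h → S⊆ c h ; (suc v) c h → proj₁ (∧-split h) })
    λ { zero    zero    c h g e → refl
      ; zero    (suc v) c h g e → ⊥-elim (clash v c h g e)
      ; (suc v) zero    c h g e → ⊥-elim (clash v c g h (sym e))
      ; (suc v) (suc w) c h g e → cong suc e }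

  private
    entry : ∀ v c → ⟦ splitRow (suc v) c ⟧ + ⟦ v == u ⟧ * ⟦ S c ⟧ ≡ ⟦ M v c ⟧
    entry v c = table (M v c) (v == u) (S c) (λ e s → subst (λ z → M z c ≡ true) (sym (==⇒≡ v u e)) (S⊆ c s))
      where
      table : ∀ m p q → (p ≡ true → q ≡ true → m ≡ true) → ⟦ m ∧ not (p ∧ q) ⟧ + ⟦ p ⟧ * ⟦ q ⟧ ≡ ⟦ m ⟧
      table true  true  true  h = refl
      table false true  true  h = case h refl refl of λ ()
      table true  true  false h = refl
      table true  false q     h = refl
      table false true  false h = refl
      table false false q     h = refl

  split-colSum : ∀ c → colSum splitRow c ≡ colSum M c
  split-colSum c = begin
    colSum splitRow c
      ≡⟨ ∑-allFin-suc (λ v → ⟦ splitRow v c ⟧) ⟩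
    ⟦ S c ⟧ + ∑ (allFin a) (λ v → ⟦ splitRow (suc v) c ⟧)
      ≡⟨ trans (+-comm ⟦ S c ⟧ _) (cong (∑ (allFin a) (λ v → ⟦ splitRow (suc v) c ⟧) +_) (sym (∑-delta u (λ _ → ⟦ S c ⟧)))) ⟩
    ∑ (allFin a) (λ v → ⟦ splitRow (suc v) c ⟧) + ∑ (allFin a) (λ v → ⟦ v == u ⟧ * ⟦ S c ⟧)
      ≡⟨ ∑-+ (allFin a) _ _ ⟨
    ∑ (allFin a) (λ v → ⟦ splitRow (suc v) c ⟧ + ⟦ v == u ⟧ * ⟦ S c ⟧)
      ≡⟨ ∑-cong (allFin a) (λ v → entry v c) ⟩
    colSum M c ∎
    where open ≡-Reasoning

  split-rowSum : ∀ v → rowSum splitRow (suc v) + ⟦ v == u ⟧ * ∑ (allFin b) (⟦_⟧ ∘ S) ≡ rowSum M v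
  split-rowSum v = trans (cong (rowSum splitRow (suc v) +_) (sym (∑-* (allFin b) ⟦ v == u ⟧ _)))
                   (trans (sym (∑-+ (allFin b) _ _)) (∑-cong (allFin b) (entry v)))

-- The potential for repeated splitting. Each split lowers it by exactly δ and adds one row, so it
-- bounds both the recursion and the final number of rows.
excess : ∀ {a b} → ℕ → Matrix a b → ℕ
excess {a} δ M = ∑ (allFin a) (λ v → rowSum M v ∸ δ)

record RowSplit {a b} (t δ : ℕ) (M : Matrix a b) : Set where
  field
    {a′}  : ℕ
    M′    : Matrix a′ b
    back  : Pattern t M′ → Pattern t M
    rows≤ : ∀ v → rowSum M′ v ≤ 2 * δ
    cols≡ : ∀ c → colSum M′ c ≡ colSum M c
    count : a′ * δ ≤ a * δ + excess δ M

-- Exactly δ columns are split off a row of degree at least 2δ. The new row has excess 0 and the old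
-- one keeps degree at least δ, so truncation does not interfere with the drop of the potential.
split-rows : ∀ {b t′} δ .{{_ : NonZero δ}} fuel {a} (M : Matrix a b) → excess δ M ≤ fuel → RowSplit (suc t′) δ M
split-rows {b} δ fuel {a} M h with Fin.any? (λ u → 2 * δ ≤? rowSum M u)
... | no none = record
  { M′ = M ; back = λ p → p ; cols≡ = λ _ → refl ; count = m≤m+n _ _
  ; rows≤ = λ v → <⇒≤ (≰⇒> (λ le → none (v , le))) }
... | yes (u , large) with subset-of-size (M u) δ (≤-trans (m≤m+n δ _) large)
... | S , S⊆ , size-S = continue fuel h
  where
  M₁ : Matrix (suc a) b
  M₁ = splitRow M u S S⊆
  shrink : ∀ p {n m} → n + ⟦ p ⟧ * δ ≡ m → (p ≡ true → 2 * δ ≤ m) → (n ∸ δ) + ⟦ p ⟧ * δ ≡ m ∸ δ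
  shrink false {n} e _ = trans (+-identityʳ (n ∸ δ)) (cong (_∸ δ) (trans (sym (+-identityʳ n)) e))
  shrink true {n} refl le = trans (+-comm (n ∸ δ) (1 * δ)) (trans (sym (+-∸-assoc (1 * δ) δ≤n)) (cong (_∸ δ) (+-comm (1 * δ) n)))
    where
    δ≤n : δ ≤ n
    δ≤n = +-cancelʳ-≤ (1 * δ) δ n (le refl)
  excess-drop : excess δ M₁ + δ ≡ excess δ M
  excess-drop = begin
    excess δ M₁ + δ
      ≡⟨ cong (_+ δ) (trans (∑-allFin-suc (λ v → rowSum M₁ v ∸ δ)) (cong (_+ rest) (trans (cong (_∸ δ) size-S) (n∸n≡0 δ)))) ⟩
    rest + δ
      ≡⟨ cong (rest +_) (sym (∑-delta u (λ _ → δ))) ⟩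
    rest + ∑ (allFin a) (λ v → ⟦ v == u ⟧ * δ)
      ≡⟨ ∑-+ (allFin a) _ _ ⟨
    ∑ (allFin a) (λ v → (rowSum M₁ (suc v) ∸ δ) + ⟦ v == u ⟧ * δ)
      ≡⟨ ∑-cong (allFin a) (λ v → shrink (v == u)
           (trans (cong (λ s → rowSum M₁ (suc v) + ⟦ v == u ⟧ * s) (sym size-S)) (split-rowSum M u S S⊆ v))
           (λ e → subst (λ z → 2 * δ ≤ rowSum M z) (sym (==⇒≡ v u e)) large)) ⟩
    excess δ M ∎
    where
    open ≡-Reasoning
    rest = ∑ (allFin a) (λ v → rowSum M₁ (suc v) ∸ δ)
  lower : ∀ {n} → excess δ M ≤ n → excess δ M₁ < n
  lower le = ≤-trans (≤-trans (≤-reflexive (sym (+-comm (excess δ M₁) 1))) (+-monoʳ-≤ (excess δ M₁) (>-nonZero⁻¹ δ)))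
                     (≤-trans (≤-reflexive excess-drop) le)
  continue : ∀ fuel → excess δ M ≤ fuel → RowSplit _ δ M
  continue zero       le = case lower le of λ ()
  continue (suc fuel) le = record
    { M′ = M′ ; back = split-pattern M u S S⊆ ∘ back ; rows≤ = rows≤
    ; cols≡ = λ c → trans (cols≡ c) (split-colSum M u S S⊆ c)
    ; count = ≤-trans count (≤-reflexive (trans (regroup δ (a * δ) (excess δ M₁)) (cong (a * δ +_) excess-drop))) }
    where
    open RowSplit (split-rows δ fuel M₁ (s≤s⁻¹ (lower le)))
    regroup : ∀ d m e → d + m + e ≡ m + (e + d)
    regroup = solve-∀

record Regularised {a b} (t δ : ℕ) (M : Matrix a b) : Set where
  field
    {a′ b′} : ℕ
    M′      : Matrix a′ b′
    back    : Pattern t M′ → Pattern t M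
    rows≤   : ∀ v → rowSum M′ v ≤ 2 * δ
    cols≤   : ∀ w → colSum M′ w ≤ 2 * δ
    size≡   : size M′ ≡ size M
    a′-few  : a′ * δ ≤ a * δ + size M
    b′-few  : b′ * δ ≤ b * δ + size M

-- Splitting rows leaves all column sums unchanged, so the columns can be treated afterwards,
-- through the transpose, without spoiling the rows.
regularise : ∀ {a b t′} δ .{{_ : NonZero δ}} (M : Matrix a b) → Regularised (suc t′) δ M
regularise {a} {b} δ M = record
  { M′ = flip K.M′ ; back = L.back ∘ transpose-pattern ∘ K.back ∘ transpose-pattern
  ; rows≤ = λ v → ≤-trans (≤-reflexive (K.cols≡ v)) (L.rows≤ v)
  ; cols≤ = K.rows≤
  ; size≡ = trans (trans (sym (size-flip (flip K.M′))) (trans (sym (size-flip K.M′)) (∑-cong (allFin L.a′) K.cols≡))) same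
  ; a′-few = ≤-trans L.count (+-monoʳ-≤ (a * δ) (∑-mono (allFin a) (λ v → m∸n≤m (rowSum M v) δ)))
  ; b′-few = ≤-trans K.count (+-monoʳ-≤ (b * δ) (≤-trans (∑-mono (allFin b) (λ w → m∸n≤m (colSum L.M′ w) δ))
                                                          (≤-reflexive (trans (size-flip L.M′) same)))) }
  where
  module L = RowSplit (split-rows δ _ M ≤-refl)
  module K = RowSplit (split-rows δ _ (flip L.M′) ≤-refl)
  same : size L.M′ ≡ size M
  same = trans (sym (size-flip L.M′)) (trans (∑-cong (allFin b) L.cols≡) (size-flip M))

-- Bipartite subgraphs

-- Rows are taken from one side and columns from the other, so that each crossing edge is a single
-- cell.
cut : ∀ {n} → (Fin n → Bool) → Matrix n n → Matrix n n
cut side adj i j = (side i ∧ not (side j)) ∧ adj i j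

-- Vertices are inserted one by one, each opposite to the majority of its neighbours placed before
-- it, which cuts at least half of the edges just added.
large-cut : ∀ n (adj : Matrix n n) → (∀ i j → adj i j ≡ adj j i) →
            ∃ λ side → ∑ (allFin n) (λ i → ∑ (allFin n) (λ j → ⟦ (toℕ i <ᵇ toℕ j) ∧ adj i j ⟧)) ≤ 2 * size (cut side adj)
large-cut zero    adj sym-adj = (λ ()) , z≤n
large-cut (suc n) adj sym-adj = extend (large-cut n adj′ (λ i j → sym-adj (suc i) (suc j)))
  where
  adj′ : Matrix n n
  adj′ i j = adj (suc i) (suc j)
  edges′ = ∑ (allFin n) (λ i → ∑ (allFin n) (λ j → ⟦ (toℕ i <ᵇ toℕ j) ∧ adj′ i j ⟧))
  deg = ∑ (allFin n) (λ j → ⟦ adj zero (suc j) ⟧)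
  edges≡ : ∑ (allFin (suc n)) (λ i → ∑ (allFin (suc n)) (λ j → ⟦ (toℕ i <ᵇ toℕ j) ∧ adj i j ⟧)) ≡ deg + edges′
  edges≡ = trans (∑-allFin-suc (λ i → ∑ (allFin (suc n)) (λ j → ⟦ (toℕ i <ᵇ toℕ j) ∧ adj i j ⟧)))
    (cong₂ _+_ (∑-allFin-suc (λ j → ⟦ (0 <ᵇ toℕ j) ∧ adj zero j ⟧))
               (∑-cong (allFin n) (λ i → ∑-allFin-suc (λ j → ⟦ (suc (toℕ i) <ᵇ toℕ j) ∧ adj (suc i) j ⟧))))
  Result = ∃ λ side → ∑ (allFin (suc n)) (λ i → ∑ (allFin (suc n)) (λ j → ⟦ (toℕ i <ᵇ toℕ j) ∧ adj i j ⟧)) ≤ 2 * size (cut side adj)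
  extend : (∃ λ side → edges′ ≤ 2 * size (cut side adj′)) → Result
  extend (side , ih) = by (≤-total p q)
    where
    p = ∑ (allFin n) (λ j → ⟦ side j ∧ adj (suc j) zero ⟧)
    q = ∑ (allFin n) (λ j → ⟦ not (side j) ∧ adj zero (suc j) ⟧)
    put : Bool → Fin (suc n) → Bool
    put s zero    = s
    put s (suc i) = side i
    deg≤ : deg ≤ p + q
    deg≤ = ≤-trans (∑-mono (allFin n) (λ j → subst (λ e → ⟦ adj zero (suc j) ⟧ ≤ ⟦ side j ∧ e ⟧ + ⟦ not (side j) ∧ adj zero (suc j) ⟧) (sym-adj zero (suc j))
                     (table (side j) (adj zero (suc j)))))
                   (≤-reflexive (∑-+ (allFin n) _ _))
      where
      table : ∀ s e → ⟦ e ⟧ ≤ ⟦ s ∧ e ⟧ + ⟦ not s ∧ e ⟧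
      table true  e = m≤m+n _ _
      table false e = ≤-refl
    cut-size : ∀ s → size (cut (put s) adj)
      ≡ ∑ (allFin (suc n)) (λ j → ⟦ cut (put s) adj zero j ⟧)
        + (∑ (allFin n) (λ i → ⟦ cut (put s) adj (suc i) zero ⟧) + size (cut side adj′))
    cut-size s = trans (∑-allFin-suc (rowSum (cut (put s) adj))) (cong (rowSum (cut (put s) adj) zero +_)
      (trans (∑-cong (allFin n) (λ i → ∑-allFin-suc (λ j → ⟦ cut (put s) adj (suc i) j ⟧))) (∑-+ (allFin n) _ _)))
    q≤ : q ≤ ∑ (allFin (suc n)) (λ j → ⟦ cut (put true) adj zero j ⟧)
    q≤ = ≤-reflexive (sym (∑-allFin-suc (λ j → ⟦ cut (put true) adj zero j ⟧)))
    p≤ : p ≤ ∑ (allFin n) (λ i → ⟦ cut (put false) adj (suc i) zero ⟧)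
    p≤ = ∑-mono (allFin n) (λ i → table (side i) (adj (suc i) zero))
      where
      table : ∀ s e → ⟦ s ∧ e ⟧ ≤ ⟦ (s ∧ true) ∧ e ⟧
      table true  e = ≤-refl
      table false e = z≤n
    conclude : ∀ s r → deg ≤ 2 * r → r + size (cut side adj′) ≤ size (cut (put s) adj) → Result
    conclude s r d≤ le = put s , ≤-trans (≤-reflexive edges≡) (≤-trans (+-mono-≤ d≤ ih)
      (≤-trans (≤-reflexive (sym (*-distribˡ-+ 2 r _))) (*-monoʳ-≤ 2 le)))
    by : p ≤ q ⊎ q ≤ p → Result
    by (inj₁ p≤q) = conclude true q
      (≤-trans deg≤ (≤-trans (+-monoˡ-≤ q p≤q) (≤-reflexive (cong (q +_) (sym (+-identityʳ q))))))
      (≤-trans (+-mono-≤ q≤ (m≤n+m _ _)) (≤-reflexive (sym (cut-size true))))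
    by (inj₂ q≤p) = conclude false p
      (≤-trans deg≤ (≤-trans (+-monoʳ-≤ p q≤p) (≤-reflexive (cong (p +_) (sym (+-identityʳ p))))))
      (≤-trans (+-monoˡ-≤ (size (cut side adj′)) p≤) (≤-trans (m≤n+m _ (rowSum (cut (put false) adj) zero)) (≤-reflexive (sym (cut-size false)))))

open import Defs hiding (sym)

pattern⇒ContainsH : ∀ {n t} (G : SimpleGraph n) side → Pattern t (cut side (adj G)) → ContainsH t t G
pattern⇒ContainsH {n} {t} G side p = f , injective , edge
  where
  open Pattern p
  f : HVertex t t → Fin n
  f (x i)  = R i
  f (y i)  = P i
  f (x' j) = Q j
  f (y' j) = S j
  adjacent : ∀ {i j} → cut side (adj G) i j ≡ true → adj G i j ≡ true
  adjacent {i} {j} h = proj₂ (∧-split {side i ∧ not (side j)} h)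
  row : ∀ {i j} → cut side (adj G) i j ≡ true → side i ≡ true
  row h = proj₁ (∧-split (proj₁ (∧-split h)))
  col : ∀ {i j} → cut side (adj G) i j ≡ true → side j ≡ false
  col {i} h = not-true (proj₂ (∧-split {side i} (proj₁ (∧-split h))))
  apart : ∀ {i j} → side i ≡ true → side j ≡ false → i ≢ j
  apart h g refl = true≢false h g
  edge : ∀ u v → HEdge t t u v → adj G (f u) (f v) ≡ true
  edge _ _ (xy i)    = adjacent (RP i)
  edge _ _ (x'y' j)  = trans (SimpleGraph.sym G _ _) (adjacent (SQ j))
  edge _ _ (xx' i j) = adjacent (RQ i j)
  edge _ _ (yy' i j) = trans (SimpleGraph.sym G _ _) (adjacent (SP j i))
  injective : Injective _≡_ _≡_ f
  injective {x i}  {x j}  e = cong x (R-inj e)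
  injective {x i}  {y j}  e = ⊥-elim (apart (row (RP i)) (col (RP j)) e)
  injective {x i}  {x' j} e = ⊥-elim (apart (row (RP i)) (col (SQ j)) e)
  injective {x i}  {y' j} e = ⊥-elim (R≢S i j e)
  injective {y i}  {x j}  e = ⊥-elim (apart (row (RP j)) (col (RP i)) (sym e))
  injective {y i}  {y j}  e = cong y (P-inj e)
  injective {y i}  {x' j} e = ⊥-elim (P≢Q i j e)
  injective {y i}  {y' j} e = ⊥-elim (apart (row (SQ j)) (col (RP i)) (sym e))
  injective {x' i} {x j}  e = ⊥-elim (apart (row (RP j)) (col (SQ i)) (sym e))
  injective {x' i} {y j}  e = ⊥-elim (P≢Q j i (sym e))
  injective {x' i} {x' j} e = cong x' (Q-inj e)
  injective {x' i} {y' j} e = ⊥-elim (apart (row (SQ j)) (col (SQ i)) (sym e))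
  injective {y' i} {x j}  e = ⊥-elim (R≢S j i (sym e))
  injective {y' i} {y j}  e = ⊥-elim (apart (row (SQ i)) (col (RP j)) e)
  injective {y' i} {x' j} e = ⊥-elim (apart (row (SQ i)) (col (SQ j)) e)
  injective {y' i} {y' j} e = cong y' (S-inj e)

-- Numerical estimates

^-cancelˡ-≤ : ∀ N .{{_ : NonZero N}} m n → m ^ N ≤ n ^ N → m ≤ n
^-cancelˡ-≤ N m n h = ≮⇒≥ (λ n<m → <⇒≱ (^-monoˡ-< N n<m) h)

n≤2^n : ∀ n → n ≤ 2 ^ n
n≤2^n zero    = z≤n
n≤2^n (suc n) = ≤-trans (+-mono-≤ (m^n>0 2 n) (n≤2^n n)) (≤-reflexive (cong (2 ^ n +_) (sym (+-identityʳ (2 ^ n)))))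

m<n*[1+m/n] : ∀ m n .{{_ : NonZero n}} → m < n * suc (m / n)
m<n*[1+m/n] m n = begin-strict
  m                      ≡⟨ m≡m%n+[m/n]*n m n ⟩
  m % n + m / n * n      <⟨ +-monoˡ-< (m / n * n) (m%n<n m n) ⟩
  suc (m / n) * n        ≡⟨ *-comm (suc (m / n)) n ⟩
  n * suc (m / n)        ∎
  where open ≤-Reasoning

n*[m/n]≤m : ∀ m n .{{_ : NonZero n}} → n * (m / n) ≤ m
n*[m/n]≤m m n = ≤-trans (≤-reflexive (*-comm n (m / n))) (m/n*n≤m m n)

m≤o/n : ∀ m n {o} .{{_ : NonZero n}} → n * m ≤ o → m ≤ o / n
m≤o/n m n {o} h = ≤-trans (≤-reflexive (sym (m*n/n≡m m n))) (/-monoˡ-≤ n (≤-trans (≤-reflexive (*-comm m n)) h))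

-- The exponents in `dense` are 2t + 1 and 2t - 1. It is what remains of the failure of the claimed
-- bound after passing to a cut and rounding E/n down.
module Estimates (t′ n δ : ℕ) .{{_ : NonZero t′}} .{{_ : NonZero n}} .{{_ : NonZero δ}}
  (dense : (2 ^ 14 * suc t′) ^ suc (suc (suc (t′ + t′))) * n ^ suc (t′ + t′) ≤ δ ^ suc (suc (suc (t′ + t′))))
  (δ≤n : δ ≤ n) where

  private
    t k α j N : ℕ
    t = suc t′
    k = t′ + t′
    α = 2 ^ 14 * t
    j = suc k
    N = suc (suc j)
    instance
      α≢0 : NonZero α
      α≢0 = m*n≢0 (2 ^ 14) t
      kn≢0 : NonZero (1024 * n)
      kn≢0 = m*n≢0 1024 n
      qn≢0 : NonZero (2048 * n)
      qn≢0 = m*n≢0 2048 n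
      2δ≢0 : NonZero (2 * δ)
      2δ≢0 = m*n≢0 2 δ

  -- Z compares with the number of family cycles at a typical edge: size-bound with at most 3n rows and columns gives
  -- δ³ ≤ 3⁴ · 8 · n · Z, which 1024 > 648 contradicts.  Θ is the largest cap for which the stars stay negligible.
  W Z Θ : ℕ
  W = 16 * t * (2 * δ) ^ k
  instance
    W≢0 : NonZero W
    W≢0 = m*n≢0 (16 * t) ((2 * δ) ^ k) {{m*n≢0 16 t}} {{m^n≢0 (2 * δ) k}}
  Z = δ ^ 3 / (1024 * n)
  Θ = Z ^ t / W

  private
    -- This comes from squaring `dense`. It needs 2t + 1 ≤ 2(2t - 1), hence t ≥ 2.
    quadratic : α * α * n ≤ δ * δ
    quadratic = ^-cancelˡ-≤ N (α * α * n) (δ * δ) (begin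
      (α * α * n) ^ N                          ≡⟨ trans (*-distrib-^ (α * α) n N) (cong (_* n ^ N) (*-distrib-^ α α N)) ⟩
      α ^ N * α ^ N * n ^ N                    ≤⟨ *-monoʳ-≤ (α ^ N * α ^ N) (^-monoʳ-≤ n N≤j+j) ⟩
      α ^ N * α ^ N * n ^ (j + j)              ≡⟨ cong (α ^ N * α ^ N *_) (^-distribˡ-+-* n j j) ⟩
      α ^ N * α ^ N * (n ^ j * n ^ j)          ≡⟨ regroup (α ^ N) (n ^ j) ⟩
      (α ^ N * n ^ j) * (α ^ N * n ^ j)        ≤⟨ *-mono-≤ dense dense ⟩
      δ ^ N * δ ^ N                            ≡⟨ *-distrib-^ δ δ N ⟨
      (δ * δ) ^ N                              ∎)
      where
      open ≤-Reasoning
      regroup : ∀ a n → a * a * (n * n) ≡ (a * n) * (a * n)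
      regroup = solve-∀
      2≤k : 2 ≤ k
      2≤k = +-mono-≤ (>-nonZero⁻¹ t′) (>-nonZero⁻¹ t′)
      N≤j+j : N ≤ j + j
      N≤j+j = ≤-trans (≤-reflexive (+-comm 2 j)) (+-monoʳ-≤ j (≤-trans 2≤k (n≤1+n k)))

    1024≤2^14 : 1024 * 8 ≤ 2 ^ 14
    1024≤2^14 = ≤ᵇ⇒≤ (1024 * 8) (2 ^ 14) _

  -- By `quadratic`, δ³/n is at least α² times δ, which covers the factor 1024 · 8t.
  8tδ≤Z : 8 * t * δ ≤ Z
  8tδ≤Z = m≤o/n (8 * t * δ) (1024 * n) (begin
    1024 * n * (8 * t * δ)        ≡⟨ regroup₁ 1024 n 8 t δ ⟩
    1024 * 8 * t * n * δ          ≤⟨ *-monoˡ-≤ δ (*-monoˡ-≤ n (*-monoˡ-≤ t 1024≤2^14)) ⟩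
    α * n * δ                     ≤⟨ *-monoˡ-≤ δ (*-monoˡ-≤ n (m≤n*m α α)) ⟩
    α * α * n * δ                 ≤⟨ *-monoˡ-≤ δ quadratic ⟩
    δ * δ * δ                     ≡⟨ regroup₂ δ ⟩
    δ ^ 3                         ∎)
    where
    open ≤-Reasoning
    regroup₁ : ∀ a n b t d → a * n * (b * t * d) ≡ a * b * t * n * d
    regroup₁ = solve-∀
    regroup₂ : ∀ d → d * d * d ≡ d * (d * (d * 1))
    regroup₂ = solve-∀

  instance
    Z≢0 : NonZero Z
    Z≢0 = >-nonZero (≤-trans (>-nonZero⁻¹ (8 * t * δ) {{m*n≢0 (8 * t) δ {{m*n≢0 8 t}}}}) 8tδ≤Z)

  nZ≤δ³ : 1024 * n * Z ≤ δ ^ 3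
  nZ≤δ³ = n*[m/n]≤m (δ ^ 3) (1024 * n)

  private
    q : ℕ
    q = 2048 * n

    -- Rounding down loses at most a factor two once `Z` is positive.
    δ³≤qZ : δ ^ 3 ≤ q * Z
    δ³≤qZ = begin
      δ ^ 3                          ≤⟨ <⇒≤ (m<n*[1+m/n] (δ ^ 3) (1024 * n)) ⟩
      1024 * n * suc Z               ≤⟨ *-monoʳ-≤ (1024 * n) (+-monoˡ-≤ Z (>-nonZero⁻¹ Z)) ⟩
      1024 * n * (Z + Z)             ≡⟨ regroup 1024 n Z ⟩
      (1024 + 1024) * n * Z          ∎
      where
      open ≤-Reasoning
      regroup : ∀ c n z → c * n * (z + z) ≡ (c + c) * n * z
      regroup = solve-∀

    base : ℕ
    base = 64 * (α * n) ^ t * δ ^ j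

    -- The origin of 2^14: the factor t ≤ 2^t, the 4^t gathered from the powers of two, and the
    -- 2048^t from `q` combine to (2 · 4 · 2048)^t.
    WΘ-base : 2 * (4 * δ) * (q ^ t * (2 * W)) ≤ base
    WΘ-base = begin
      2 * (4 * δ) * (q ^ t * (2 * (16 * t * (2 * δ) ^ k)))
        ≡⟨ cong₂ (λ p r → 2 * (4 * δ) * (p * (2 * (16 * t * r)))) (*-distrib-^ 2048 n t) (*-distrib-^ 2 δ k) ⟩
      2 * (4 * δ) * (2048 ^ t * n ^ t * (2 * (16 * t * (2 ^ k * δ ^ k))))
        ≡⟨ regroup δ (2048 ^ t) (n ^ t) t (2 ^ k) (δ ^ k) ⟩
      64 * (t * (2 * 2 * 2 ^ k) * 2048 ^ t * n ^ t) * (δ * δ ^ k)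
        ≡⟨ cong (λ p → 64 * (t * p * 2048 ^ t * n ^ t) * (δ * δ ^ k)) four^t ⟩
      64 * (t * 4 ^ t * 2048 ^ t * n ^ t) * δ ^ j
        ≤⟨ *-monoˡ-≤ (δ ^ j) (*-monoʳ-≤ 64 (*-monoˡ-≤ (n ^ t) (*-monoˡ-≤ (2048 ^ t) (*-monoˡ-≤ (4 ^ t) (n≤2^n t))))) ⟩
      64 * (2 ^ t * 4 ^ t * 2048 ^ t * n ^ t) * δ ^ j
        ≡⟨ cong (λ p → 64 * p * δ ^ j) (trans (cong (λ p → p * 2048 ^ t * n ^ t) (sym (*-distrib-^ 2 4 t)))
             (trans (cong (_* n ^ t) (sym (*-distrib-^ (2 * 4) 2048 t))) (sym (*-distrib-^ (2 * 4 * 2048) n t)))) ⟩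
      64 * (2 ^ 14 * n) ^ t * δ ^ j
        ≤⟨ *-monoˡ-≤ (δ ^ j) (*-monoʳ-≤ 64 (^-monoˡ-≤ t (*-monoˡ-≤ n (m≤m*n (2 ^ 14) t)))) ⟩
      base ∎
      where
      open ≤-Reasoning
      regroup : ∀ d p n t r s → 2 * (4 * d) * (p * n * (2 * (16 * t * (r * s)))) ≡ 64 * (t * (2 * 2 * r) * p * n) * (d * s)
      regroup = solve-∀
      four^t : 2 * 2 * 2 ^ k ≡ 4 ^ t
      four^t = trans (cong (4 *_) (trans (^-distribˡ-+-* 2 t′ t′) (sym (*-distrib-^ 2 2 t′)))) refl

    -- The t-th power of `dense` replaces n by δ. The identity t(2t + 1) + (2t - 1)² = 3t(2t - 1) +
    -- 1 then makes the exponents of δ match.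
    base^j : base ^ j ≤ δ * ((δ ^ 3) ^ t) ^ j
    base^j = begin
      base ^ j
        ≡⟨ trans (*-distrib-^ (64 * (α * n) ^ t) (δ ^ j) j) (cong (_* (δ ^ j) ^ j) (*-distrib-^ 64 ((α * n) ^ t) j)) ⟩
      64 ^ j * ((α * n) ^ t) ^ j * (δ ^ j) ^ j
        ≤⟨ *-monoˡ-≤ ((δ ^ j) ^ j) (*-mono-≤ 64^j (≤-reflexive (exchange (α * n)))) ⟩
      (α * α) ^ t * ((α * n) ^ j) ^ t * (δ ^ j) ^ j
        ≡⟨ cong (_* (δ ^ j) ^ j) (trans (sym (*-distrib-^ (α * α) ((α * n) ^ j) t))
             (cong (_^ t) (trans (cong (α * α *_) (*-distrib-^ α n j)) (regroup α (α ^ j) (n ^ j))))) ⟩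
      (α ^ N * n ^ j) ^ t * (δ ^ j) ^ j
        ≤⟨ *-monoˡ-≤ ((δ ^ j) ^ j) (^-monoˡ-≤ t dense) ⟩
      (δ ^ N) ^ t * (δ ^ j) ^ j
        ≡⟨ trans (cong₂ _*_ (^-*-assoc δ N t) (^-*-assoc δ j j)) (sym (^-distribˡ-+-* δ (N * t) (j * j))) ⟩
      δ ^ (N * t + j * j)
        ≡⟨ cong (δ ^_) (exponents t′) ⟩
      δ * δ ^ (3 * t * j)
        ≡⟨ cong (δ *_) (trans (sym (^-*-assoc δ (3 * t) j)) (cong (_^ j) (sym (^-*-assoc δ 3 t)))) ⟩
      δ * ((δ ^ 3) ^ t) ^ j ∎
      where
      open ≤-Reasoning
      exchange : ∀ m → (m ^ t) ^ j ≡ (m ^ j) ^ t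
      exchange m = trans (^-*-assoc m t j) (trans (cong (m ^_) (*-comm t j)) (sym (^-*-assoc m j t)))
      regroup : ∀ a p n → a * a * (p * n) ≡ a * (a * p) * n
      regroup = solve-∀
      exponents : ∀ t′ → suc (suc (suc (t′ + t′))) * suc t′ + suc (t′ + t′) * suc (t′ + t′) ≡ suc (3 * suc t′ * suc (t′ + t′))
      exponents = solve-∀
      64^j : 64 ^ j ≤ (α * α) ^ t
      64^j = begin
        64 ^ j            ≤⟨ ^-monoˡ-≤ j (≤-trans (≤ᵇ⇒≤ 64 (2 ^ 14) _) (m≤m*n (2 ^ 14) t)) ⟩
        α ^ j             ≤⟨ ^-monoʳ-≤ α (≤-trans (n≤1+n j) (≤-reflexive (cong suc (sym (+-suc t′ t′))))) ⟩
        α ^ (t + t)       ≡⟨ trans (^-distribˡ-+-* α t t) (sym (*-distrib-^ α α t)) ⟩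
        (α * α) ^ t       ∎

    -- Stated for any θ that is not too small, because it is used twice: for `Θ` itself, and for θ =
    -- 1 in showing that `Θ` is not zero.
    Θ-sufficient : ∀ θ → Z ^ t ≤ 2 * W * θ → j * (4 * δ) ^ j ≤ δ * θ ^ j
    Θ-sufficient θ h = *-cancelʳ-≤ (j * (4 * δ) ^ j) (δ * θ ^ j) (c ^ j) {{m^n≢0 c j {{c≢0}}}} (begin
      j * (4 * δ) ^ j * c ^ j            ≤⟨ *-monoˡ-≤ (c ^ j) (*-monoˡ-≤ ((4 * δ) ^ j) (n≤2^n j)) ⟩
      2 ^ j * (4 * δ) ^ j * c ^ j        ≡⟨ trans (cong (_* c ^ j) (sym (*-distrib-^ 2 (4 * δ) j))) (sym (*-distrib-^ (2 * (4 * δ)) c j)) ⟩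
      (2 * (4 * δ) * c) ^ j              ≤⟨ ^-monoˡ-≤ j WΘ-base ⟩
      base ^ j                           ≤⟨ base^j ⟩
      δ * ((δ ^ 3) ^ t) ^ j              ≤⟨ *-monoʳ-≤ δ (^-monoˡ-≤ j (^-monoˡ-≤ t δ³≤qZ)) ⟩
      δ * ((q * Z) ^ t) ^ j              ≡⟨ cong (λ p → δ * p ^ j) (*-distrib-^ q Z t) ⟩
      δ * (q ^ t * Z ^ t) ^ j            ≤⟨ *-monoʳ-≤ δ (^-monoˡ-≤ j (*-monoʳ-≤ (q ^ t) h)) ⟩
      δ * (q ^ t * (2 * W * θ)) ^ j      ≡⟨ cong (λ p → δ * p ^ j) (sym (*-assoc (q ^ t) (2 * W) θ)) ⟩
      δ * (c * θ) ^ j                    ≡⟨ cong (δ *_) (*-distrib-^ c θ j) ⟩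
      δ * (c ^ j * θ ^ j)                ≡⟨ regroup δ (c ^ j) (θ ^ j) ⟩
      δ * θ ^ j * c ^ j                  ∎)
      where
      open ≤-Reasoning
      c = q ^ t * (2 * W)
      c≢0 : NonZero c
      c≢0 = m*n≢0 (q ^ t) (2 * W) {{m^n≢0 q t}} {{m*n≢0 2 W}}
      regroup : ∀ d p r → d * (p * r) ≡ d * r * p
      regroup = solve-∀

    W≤Z^t : W ≤ Z ^ t
    -- If Z^t < W, then already θ = 1 would be sufficient, which is absurd because j(4δ)^j exceeds
    -- δ.
    W≤Z^t = ≮⇒≥ λ small → <-irrefl refl (begin-strict
      δ                          <⟨ m<m+n δ (≤-trans (>-nonZero⁻¹ δ) (m≤m+n δ _)) ⟩
      4 * δ                      ≤⟨ m≤m*n (4 * δ) ((4 * δ) ^ k) {{m^n≢0 (4 * δ) k {{m*n≢0 4 δ}}}} ⟩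
      (4 * δ) ^ j                ≤⟨ m≤m+n _ _ ⟩
      j * (4 * δ) ^ j            ≤⟨ Θ-sufficient 1 (≤-trans (<⇒≤ small) (≤-trans (m≤m+n W _) (≤-reflexive (sym (*-identityʳ (2 * W)))))) ⟩
      δ * 1 ^ j                  ≡⟨ trans (cong (δ *_) (^-zeroˡ j)) (*-identityʳ δ) ⟩
      δ                          ∎)
      where open ≤-Reasoning

  instance
    Θ≢0 : NonZero Θ
    Θ≢0 = >-nonZero (m≤o/n 1 W (≤-trans (≤-reflexive (*-identityʳ W)) W≤Z^t))

  WΘ≤Z^t : W * Θ ≤ Z ^ t
  WΘ≤Z^t = n*[m/n]≤m (Z ^ t) W

  Θ-large : j * (2 * (2 * δ)) ^ j ≤ 2 * δ * Θ ^ j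
  Θ-large = begin
    j * (2 * (2 * δ)) ^ j     ≡⟨ cong (λ p → j * p ^ j) (sym (*-assoc 2 2 δ)) ⟩
    j * (4 * δ) ^ j           ≤⟨ Θ-sufficient Θ (begin
      Z ^ t                     ≤⟨ <⇒≤ (m<n*[1+m/n] (Z ^ t) W) ⟩
      W * suc Θ                 ≤⟨ *-monoʳ-≤ W (+-monoˡ-≤ Θ (>-nonZero⁻¹ Θ)) ⟩
      W * (Θ + Θ)               ≡⟨ regroup W Θ ⟩
      2 * W * Θ                 ∎) ⟩
    δ * Θ ^ j                 ≤⟨ *-monoˡ-≤ (Θ ^ j) (m≤m+n δ _) ⟩
    2 * δ * Θ ^ j             ∎
    where
    open ≤-Reasoning
    regroup : ∀ w x → w * (x + x) ≡ 2 * w * x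
    regroup = solve-∀

  -- Since δ ≤ n, Z ≤ δ²; hence W Θ ≤ Z^t ≤ Z (2δ)^(2t-2), and cancelling the last power leaves 16tΘ
  -- ≤ Z.
  lower-order : 3 * (t * (Θ + Θ)) + 2 * (t + t) * (2 * δ) ≤ 2 * Z
  lower-order = begin
    3 * (t * (Θ + Θ)) + 2 * (t + t) * (2 * δ)  ≡⟨ regroup₁ t Θ δ ⟩
    6 * t * Θ + 8 * t * δ                      ≤⟨ +-mono-≤ (*-monoˡ-≤ Θ (*-monoˡ-≤ t (≤ᵇ⇒≤ 6 16 _))) 8tδ≤Z ⟩
    16 * t * Θ + Z                             ≤⟨ +-monoˡ-≤ Z 16tΘ≤Z ⟩
    Z + Z                                      ≡⟨ cong (Z +_) (sym (+-identityʳ Z)) ⟩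
    2 * Z                                      ∎
    where
    open ≤-Reasoning
    regroup₁ : ∀ t x d → 3 * (t * (x + x)) + 2 * (t + t) * (2 * d) ≡ 6 * t * x + 8 * t * d
    regroup₁ = solve-∀
    Z≤δ² : Z ≤ δ * δ
    Z≤δ² = *-cancelˡ-≤ n (begin
      n * Z                    ≤⟨ *-monoˡ-≤ Z (m≤n*m n 1024) ⟩
      1024 * n * Z             ≤⟨ nZ≤δ³ ⟩
      δ * (δ * (δ * 1))        ≡⟨ cong (λ d → δ * (δ * d)) (*-identityʳ δ) ⟩
      δ * (δ * δ)              ≤⟨ *-monoˡ-≤ (δ * δ) δ≤n ⟩
      n * (δ * δ)              ∎)
    16tΘ≤Z : 16 * t * Θ ≤ Z
    16tΘ≤Z = *-cancelʳ-≤ (16 * t * Θ) Z ((2 * δ) ^ k) {{m^n≢0 (2 * δ) k}} (begin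
      16 * t * Θ * (2 * δ) ^ k           ≡⟨ regroup₂ (16 * t) Θ ((2 * δ) ^ k) ⟩
      W * Θ                              ≤⟨ WΘ≤Z^t ⟩
      Z * Z ^ t′                         ≤⟨ *-monoʳ-≤ Z (^-monoˡ-≤ t′ (≤-trans Z≤δ² (*-mono-≤ (m≤m+n δ _) (m≤m+n δ _)))) ⟩
      Z * (2 * δ * (2 * δ)) ^ t′         ≡⟨ cong (Z *_) (trans (*-distrib-^ (2 * δ) (2 * δ) t′) (sym (^-distribˡ-+-* (2 * δ) t′ t′))) ⟩
      Z * (2 * δ) ^ k                    ∎)
      where
      regroup₂ : ∀ a x p → a * x * p ≡ a * p * x
      regroup₂ = solve-∀

  -- Each summand receives half of E Z^t. For the stars this is why `W` carries 16 where the count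
  -- has 8; for the other summand it follows from `dense`, by which n^t (nδ)^(t-1) is at most about
  -- δ^(3t).
  Z-large : ∀ E → E ≤ 2 * n * δ →
            t * (t + t + (t + t)) * E ^ t + 2 * (4 * t * (2 * δ) ^ t′ * Θ * (E * (2 * δ) ^ t′)) ≤ E * Z ^ t
  Z-large E E≤ = *-cancelˡ-≤ 2 (begin
    2 * (t * (t + t + (t + t)) * (E * E ^ t′) + 2 * (4 * t * (2 * δ) ^ t′ * Θ * (E * (2 * δ) ^ t′)))
      ≡⟨ regroup₁ t E (E ^ t′) ((2 * δ) ^ t′) Θ ⟩
    E * (8 * (t * t) * E ^ t′) + E * (16 * t * ((2 * δ) ^ t′ * (2 * δ) ^ t′) * Θ)
      ≡⟨ cong (λ p → E * (8 * (t * t) * E ^ t′) + E * (16 * t * p * Θ)) (sym (^-distribˡ-+-* (2 * δ) t′ t′)) ⟩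
    E * (8 * (t * t) * E ^ t′) + E * (W * Θ)
      ≤⟨ +-mono-≤ (*-monoʳ-≤ E first) (*-monoʳ-≤ E WΘ≤Z^t) ⟩
    E * Z ^ t + E * Z ^ t
      ≡⟨ cong (E * Z ^ t +_) (sym (+-identityʳ (E * Z ^ t))) ⟩
    2 * (E * Z ^ t) ∎)
    where
    open ≤-Reasoning
    regroup₁ : ∀ t e p s x → 2 * (t * (t + t + (t + t)) * (e * p) + 2 * (4 * t * s * x * (e * s)))
               ≡ e * (8 * (t * t) * p) + e * (16 * t * (s * s) * x)
    regroup₁ = solve-∀
    first : 8 * (t * t) * E ^ t′ ≤ Z ^ t
    first = *-cancelˡ-≤ (q ^ t) {{m^n≢0 q t}} (begin
      q ^ t * (8 * (t * t) * E ^ t′)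
        ≤⟨ *-monoʳ-≤ (q ^ t) (*-monoʳ-≤ (8 * (t * t)) (^-monoˡ-≤ t′ E≤)) ⟩
      q ^ t * (8 * (t * t) * (2 * n * δ) ^ t′)
        ≡⟨ cong₂ (λ p r → p * (8 * (t * t) * r)) (*-distrib-^ 2048 n t)
             (trans (*-distrib-^ (2 * n) δ t′) (cong (_* δ ^ t′) (*-distrib-^ 2 n t′))) ⟩
      2048 ^ t * n ^ t * (8 * (t * t) * (2 ^ t′ * n ^ t′ * δ ^ t′))
        ≡⟨ regroup₂ (2048 ^ t) (n ^ t) (t * t) (2 ^ t′) (n ^ t′) (δ ^ t′) ⟩
      8 * (t * t) * (2048 ^ t * 2 ^ t′) * (n ^ t * n ^ t′) * δ ^ t′
        ≤⟨ *-monoˡ-≤ (δ ^ t′) (*-mono-≤ (*-mono-≤ squares powers) (≤-reflexive (sym (^-distribˡ-+-* n t t′)))) ⟩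
      α * α * (α ^ t * α ^ t′) * n ^ (t + t′) * δ ^ t′
        ≡⟨ cong (λ p → α * α * p * n ^ j * δ ^ t′) (sym (^-distribˡ-+-* α t t′)) ⟩
      α * α * α ^ j * n ^ j * δ ^ t′
        ≡⟨ cong (λ p → p * n ^ j * δ ^ t′) (*-assoc α α (α ^ j)) ⟩
      α ^ N * n ^ j * δ ^ t′
        ≤⟨ *-monoˡ-≤ (δ ^ t′) dense ⟩
      δ ^ N * δ ^ t′
        ≡⟨ trans (sym (^-distribˡ-+-* δ N t′)) (trans (cong (δ ^_) (exponents t′)) (sym (^-*-assoc δ 3 t))) ⟩
      (δ ^ 3) ^ t
        ≤⟨ ^-monoˡ-≤ t δ³≤qZ ⟩
      (q * Z) ^ t
        ≡⟨ *-distrib-^ q Z t ⟩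
      q ^ t * Z ^ t ∎)
      where
      regroup₂ : ∀ p n s r m d → p * n * (8 * s * (r * m * d)) ≡ 8 * s * (p * r) * (n * m) * d
      regroup₂ = solve-∀
      exponents : ∀ t′ → suc (suc (suc (t′ + t′))) + t′ ≡ 3 * suc t′
      exponents = solve-∀
      regroup₃ : ∀ c t → c * t * (c * t) ≡ c * c * (t * t)
      regroup₃ = solve-∀
      squares : 8 * (t * t) ≤ α * α
      squares = ≤-trans (*-monoˡ-≤ (t * t) (≤ᵇ⇒≤ 8 (2 ^ 14 * 2 ^ 14) _)) (≤-reflexive (sym (regroup₃ (2 ^ 14) t)))
      powers : 2048 ^ t * 2 ^ t′ ≤ α ^ t * α ^ t′
      powers = *-mono-≤ (^-monoˡ-≤ t (≤-trans (≤ᵇ⇒≤ 2048 (2 ^ 14) _) (m≤m*n (2 ^ 14) t)))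
                        (^-monoˡ-≤ t′ (≤-trans (≤ᵇ⇒≤ 2 (2 ^ 14) _) (m≤m*n (2 ^ 14) t)))

-- From a dense matrix to the theorem

size≤ : ∀ {a b} (M : Matrix a b) → size M ≤ a * b
size≤ {a} {b} M = ≤-trans (∑-mono (allFin a) (λ v → ≤-trans (∑-mono (allFin b) (λ w → ⟦⟧≤1 (M v w)))
                    (≤-reflexive (trans (∑-const (allFin b) 1) (trans (*-identityʳ _) (length-allFin b))))))
                  (≤-reflexive (trans (∑-const (allFin a) b) (cong (_* b) (length-allFin a))))

-- The two bounds on `size M` say that δ is the average degree up to a factor two. The upper one
-- keeps the numbers of rows and columns after splitting at no more than 3n each.
dense⇒pattern : ∀ t′ n δ .{{_ : NonZero t′}} .{{_ : NonZero n}} .{{_ : NonZero δ}} (M : Matrix n n) →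
                n * δ ≤ size M → size M ≤ 2 * n * δ →
                (2 ^ 14 * suc t′) ^ suc (suc (suc (t′ + t′))) * n ^ suc (t′ + t′) ≤ δ ^ suc (suc (suc (t′ + t′))) →
                ¬ ¬ Pattern (suc t′) M
dense⇒pattern t′ n δ M lower upper dense free = <⇒≱ (*-monoˡ-< X {{X≢0}} (≤ᵇ⇒≤ (suc 648) 1024 _)) (begin
  1024 * X                            ≡⟨ regroup₁ 1024 n E Z ⟩
  E * (n * (n * (n * (1024 * n * Z)))) ≤⟨ *-monoʳ-≤ E (*-monoʳ-≤ n (*-monoʳ-≤ n (*-monoʳ-≤ n nZ≤δ³))) ⟩
  E * (n * (n * (n * δ ^ 3)))         ≡⟨ regroup₂ E n δ ⟩
  E * ((n * δ) * ((n * δ) * (n * δ))) ≤⟨ *-monoʳ-≤ E (*-mono-≤ lower (*-mono-≤ lower lower)) ⟩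
  E * (E * (E * E))                   ≡⟨ regroup₃ E ⟩
  E ^ 4                               ≤⟨ bound ⟩
  (a′ * b′) ^ 2 * (8 * (E * Z))       ≤⟨ *-monoˡ-≤ (8 * (E * Z)) (^-monoˡ-≤ 2 (*-mono-≤ (few a′ a′-few) (few b′ b′-few))) ⟩
  (3 * n * (3 * n)) ^ 2 * (8 * (E * Z)) ≡⟨ regroup₄ n E Z ⟩
  648 * X                             ∎)
  where
  open ≤-Reasoning
  E = size M
  instance
    E≢0 : NonZero E
    E≢0 = >-nonZero (≤-trans (>-nonZero⁻¹ (n * δ) {{m*n≢0 n δ}}) lower)
    2δ≢0 : NonZero (2 * δ)
    2δ≢0 = m*n≢0 2 δ
  δ≤n : δ ≤ n
  δ≤n = *-cancelˡ-≤ n (≤-trans lower (size≤ M))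
  open Estimates t′ n δ dense δ≤n
  open Regularised (regularise {t′ = t′} δ M)
  X = n ^ 4 * E * Z
  X≢0 : NonZero X
  X≢0 = m*n≢0 (n ^ 4 * E) Z {{m*n≢0 (n ^ 4) E {{m^n≢0 n 4}}}}
  bound : E ^ 4 ≤ (a′ * b′) ^ 2 * (8 * (E * Z))
  bound = subst (λ e → e ^ 4 ≤ (a′ * b′) ^ 2 * (8 * (e * Z))) size≡
    (size-bound (free ∘ back) rows≤ cols≤ Θ-large
      (Z-large (size M′) (≤-trans (≤-reflexive size≡) upper)) lower-order)
  few : ∀ c → c * δ ≤ n * δ + size M → c ≤ 3 * n
  few c h = *-cancelʳ-≤ c (3 * n) δ (≤-trans h (≤-trans (+-monoʳ-≤ (n * δ) upper) (≤-reflexive (regroup₅ n δ))))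
    where
    regroup₅ : ∀ n d → n * d + 2 * n * d ≡ 3 * n * d
    regroup₅ = solve-∀
  regroup₁ : ∀ c n e z → c * (n * (n * (n * (n * 1))) * e * z) ≡ e * (n * (n * (n * (c * n * z))))
  regroup₁ = solve-∀
  regroup₂ : ∀ e n d → e * (n * (n * (n * (d * (d * (d * 1)))))) ≡ e * ((n * d) * ((n * d) * (n * d)))
  regroup₂ = solve-∀
  regroup₃ : ∀ e → e * (e * (e * e)) ≡ e * (e * (e * (e * 1)))
  regroup₃ = solve-∀
  regroup₄ : ∀ n e z → 3 * n * (3 * n) * (3 * n * (3 * n) * 1) * (8 * (e * z)) ≡ 648 * (n * (n * (n * (n * 1))) * e * z)
  regroup₄ = solve-∀

theorem6p2 : ∀ (t : ℕ) → 2 ≤ t →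
    ∃ λ (N : ℕ) → ∀ (n : ℕ) → N ≤ n →
    ∀ (G : SimpleGraph n) → ¬ ContainsH t t G →
    edgeCount G ^ (2 * t + 1) ≤ (2 ^ 16 * t) ^ (2 * t + 1) * n ^ (4 * t)
-- The power 2t + 1 clears the fractional exponent, and every n ≥ 1 is large enough.
theorem6p2 t@(suc t′@(suc t″)) _ = 1 , bound
  where
  bound : ∀ n → 1 ≤ n → ∀ (G : SimpleGraph n) → ¬ ContainsH t t G →
          edgeCount G ^ (2 * t + 1) ≤ (2 ^ 16 * t) ^ (2 * t + 1) * n ^ (4 * t)
  bound n 1≤n G H-free = ≮⇒≥ λ many → impossible many (large-cut n (adj G) (SimpleGraph.sym G))
    where
    open ≤-Reasoning
    m = edgeCount G
    K j : ℕ
    K = suc (suc (suc (t′ + t′)))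
    j = suc (t′ + t′)
    C = 2 ^ 16 * t
    α = 2 ^ 14 * t
    instance
      n≢0 : NonZero n
      n≢0 = >-nonZero 1≤n
    K≡ : 2 * t + 1 ≡ K
    K≡ = exponent t′
      where
      exponent : ∀ t′ → 2 * suc t′ + 1 ≡ suc (suc (suc (t′ + t′)))
      exponent = solve-∀
    K+j≡ : 4 * t ≡ K + j
    K+j≡ = exponent t′
      where
      exponent : ∀ t′ → 4 * suc t′ ≡ suc (suc (suc (t′ + t′))) + suc (t′ + t′)
      exponent = solve-∀

    impossible : C ^ (2 * t + 1) * n ^ (4 * t) < m ^ (2 * t + 1) →
                 (∃ λ side → m ≤ 2 * size (cut side (adj G))) → ⊥
    impossible many (side , m≤2E) = dense⇒pattern t′ n δ {{it}} {{it}} {{δ≢0}} M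
        (n*[m/n]≤m E n) (E≤2nδ δ≢0) (dense δ≢0) (H-free ∘ pattern⇒ContainsH G side)
      where
      M = cut side (adj G)
      E = size M
      δ = E / n
      E<n[1+δ] : E < n * suc δ
      E<n[1+δ] = m<n*[1+m/n] E n
      many′ : C ^ K * (n ^ K * n ^ j) < m ^ K
      many′ = subst₂ (λ p r → C ^ p * r < m ^ p) K≡ (trans (cong (n ^_) K+j≡) (^-distribˡ-+-* n K j)) many
      -- If E < n, then m ≤ 2n, which is below the bound assumed to fail.
      δ≢0 : NonZero δ
      δ≢0 = ≢-nonZero λ δ≡0 → <⇒≱ many′ (begin
        m ^ K                      ≤⟨ ^-monoˡ-≤ K m≤2E ⟩
        (2 * E) ^ K                ≤⟨ ^-monoˡ-≤ K (*-monoʳ-≤ 2 (≤-trans (<⇒≤ E<n[1+δ])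
                                        (≤-reflexive (trans (cong (λ d → n * suc d) δ≡0) (*-identityʳ n))))) ⟩
        (2 * n) ^ K                ≡⟨ *-distrib-^ 2 n K ⟩
        2 ^ K * n ^ K              ≤⟨ *-mono-≤ (^-monoˡ-≤ K (≤-trans (≤ᵇ⇒≤ 2 (2 ^ 16) _) (m≤m*n (2 ^ 16) t)))
                                               (m≤m*n (n ^ K) (n ^ j) {{m^n≢0 n j}}) ⟩
        C ^ K * (n ^ K * n ^ j)    ∎)
      E≤2nδ : NonZero δ → E ≤ 2 * n * δ
      E≤2nδ nz = begin
        E               ≤⟨ <⇒≤ E<n[1+δ] ⟩
        n * suc δ       ≤⟨ *-monoʳ-≤ n (+-monoˡ-≤ δ (>-nonZero⁻¹ δ {{nz}})) ⟩
        n * (δ + δ)     ≡⟨ regroup n δ ⟩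
        2 * n * δ       ∎
        where
        regroup : ∀ n d → n * (d + d) ≡ 2 * n * d
        regroup = solve-∀
      -- The factor 4 between 2^14 and 2^16 is spent here: two for the cut, two for rounding E/n
      -- down.
      dense : NonZero δ → α ^ K * n ^ j ≤ δ ^ K
      dense nz = *-cancelˡ-≤ ((4 * n) ^ K) {{m^n≢0 (4 * n) K {{m*n≢0 4 n}}}} (begin
        (4 * n) ^ K * (α ^ K * n ^ j)       ≡⟨ cong (_* (α ^ K * n ^ j)) (*-distrib-^ 4 n K) ⟩
        4 ^ K * n ^ K * (α ^ K * n ^ j)     ≡⟨ regroup (4 ^ K) (n ^ K) (α ^ K) (n ^ j) ⟩
        4 ^ K * α ^ K * (n ^ K * n ^ j)     ≡⟨ cong (_* (n ^ K * n ^ j)) (trans (sym (*-distrib-^ 4 α K)) (cong (_^ K) (sym (*-assoc 4 (2 ^ 14) t)))) ⟩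
        C ^ K * (n ^ K * n ^ j)             ≤⟨ <⇒≤ many′ ⟩
        m ^ K                               ≤⟨ ^-monoˡ-≤ K (≤-trans m≤2E (*-monoʳ-≤ 2 (E≤2nδ nz))) ⟩
        (2 * (2 * n * δ)) ^ K               ≡⟨ cong (_^ K) (regroup′ n δ) ⟩
        (4 * n * δ) ^ K                     ≡⟨ *-distrib-^ (4 * n) δ K ⟩
        (4 * n) ^ K * δ ^ K                 ∎)
        where
        regroup : ∀ f p a r → f * p * (a * r) ≡ f * a * (p * r)
        regroup = solve-∀
        regroup′ : ∀ n d → 2 * (2 * n * d) ≡ 4 * n * d
        regroup′ = solve-∀
theorem6p2 (suc zero) (s≤s ())
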